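{- For every $n$ and $F\in\mathcal{F}_n$, $$|\mathcal{M}_F(123,321)|=\begin{cases}2^{\eta(F)}&\text{if }F\in\mathcal{F}_n^{<5},\\ 0&\text{otherwise.}\end{cases}$$ Moreover $$\sum_{n\ge0}|\mathcal{M}_n(123,321)|z^n=\frac{1-5z+2z^2}{1-6z+5z^2},\quad\text{so}\quad |\mathcal{M}_n(123,321)|=\frac{5^{n-1}+1}{2}\ (n\ge1),$$ and $$\sum_{n\ge0}|\mathcal{P}_n(123,321)|z^n=\frac{1-10z+32z^2-37z^3+12z^4}{(1-z)(1-10z+31z^2-30z^3+z^4)}.$$
   Context: A Dyck path of semilength $n$ is a lattice path from $(0,n)$ to $(n,0)$ with unit east and south steps never going strictly below $y=n-x$; its height sequence $h_0\dots h_{2n}$ has $h_0=0$ and $h_{i+1}=h_i+1$ for an east step, $h_i-1$ for a south step. Its height is $\max_i h_i$, and $\eta(D)=|\{i:h_i=2\}|$. $\mathcal{F}_n$ is the set of Ferrers boards whose border $D_F$ is such a path; $\eta(F)=\eta(D_F)$; $\mathcal{F}_n^{<5}$ is the set of $F\in\mathcal{F}_n$ whose border has height less than $5$. Perfect matchings of $[2n]$: sets of $n$ disjoint pairs $(i,j)$, $i<j$; the shape of $M$ is the board in $\mathcal{F}_n$ whose border is obtained reading $1,\dots,2n$ with an east step per opener and a south step per closer. $M$ avoids $\tau\in S_k$ if there are no $i_1<\dots<i_{2k}$ with all pairs $(i_a,i_{2k+1-\tau(a)})$ in $M$. $\mathcal{M}_F(\sigma,\tau)$, $\mathcal{M}_n(\sigma,\tau)$: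 matchings of shape $F$, resp. of $[2n]$, avoiding both patterns. Set partitions of $[n]$: arcs $(i_1,i_2),\dots,(i_{a-1},i_a)$ for each block $\{i_1<\dots<i_a\}$; avoidance defined as for matchings with arcs; $\mathcal{P}_n(\sigma,\tau)$ the partitions of $[n]$ avoiding both. -}

module Defs where

open import Data.Nat as ℕ using (ℕ; zero; suc; _+_; _*_)
open import Data.Bool using (Bool; true; false; if_then_else_)
open import Data.Bool.Properties using () renaming (_≟_ to _≟ᵇ_)
open import Data.Fin as Fin using (Fin; toℕ; _↑ˡ_; opposite)
open import Data.Fin.Properties using (all?) renaming (_≟_ to _≟ᶠ_)
open import Data.Integer as ℤ using (ℤ; +_; _⊔_)
import Data.List
open import Data.Vec using (Vec; []; _∷_; lookup; tabulate; foldr₁; last; count)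
open import Data.Vec.Properties using (≡-dec)
open import Data.Product using (_×_; _,_)
open import Relation.Nullary using (Dec; yes; no; ¬_; ¬?)
open import Relation.Nullary.Decidable using (⌊_⌋; _×-dec_; _→-dec_)
open import Relation.Binary.PropositionalEquality using (_≡_; _≢_)

sumFin : ∀ {m} → (Fin m → ℕ) → ℕ
sumFin {zero}  f = 0
sumFin {suc m} f = f Fin.zero + sumFin (λ i → f (Fin.suc i))

sumBool : (Bool → ℕ) → ℕ
sumBool f = f false + f true

sumVec : ∀ {A : Set} → ((A → ℕ) → ℕ) → (j : ℕ) → (Vec A j → ℕ) → ℕ
sumVec S zero    f = f []
sumVec S (suc j) f = S (λ x → sumVec S j (λ t → f (x ∷ t)))

countVec : ∀ {A : Set} → ((A → ℕ) → ℕ) → (j : ℕ) → {P : Vec A j → Set} →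
           (∀ v → Dec (P v)) → ℕ
countVec S j P? = sumVec S j (λ v → if ⌊ P? v ⌋ then 1 else 0)

allVec? : ∀ {m} (j : ℕ) {P : Vec (Fin m) j → Set} →
          (∀ s → Dec (P s)) → Dec (∀ s → P s)
allVec? zero P? with P? []
... | yes p = yes λ { [] → p }
... | no ¬p = no λ f → ¬p (f [])
allVec? (suc j) {P} P? with all? (λ x → allVec? j (λ t → P? (x ∷ t)))
... | yes f = yes λ { (x ∷ t) → f x t }
... | no ¬f = no λ g → ¬f (λ x t → g (x ∷ t))

-- A pattern τ ∈ S_k in one-line notation, 0-indexed: τ(a+1) = 1 + lookup τ a.
Pattern : ℕ → Set
Pattern k = Vec (Fin k) k

p123 : Pattern 3
p123 = Fin.zero ∷ Fin.suc Fin.zero ∷ Fin.suc (Fin.suc Fin.zero) ∷ []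

p321 : Pattern 3
p321 = Fin.suc (Fin.suc Fin.zero) ∷ Fin.suc Fin.zero ∷ Fin.zero ∷ []

Increasing : ∀ {m j} → Vec (Fin m) j → Set
Increasing s = ∀ a b → a Fin.< b → lookup s a Fin.< lookup s b

-- Occurrence of τ at positions s w.r.t. an arc relation Arc:
-- for every a, (i_a , i_{2k+1-τ(a)}) is an arc.  In 0-indexed form
-- position a ↦ a, partner position ↦ 2k-1-τ'(a) = opposite (τ' a).
Occurs : ∀ {m k} → (Fin m → Fin m → Set) → Pattern k → Vec (Fin m) (k + k) → Set
Occurs {k = k} Arc τ s =
  Increasing s ×
  (∀ a → Arc (lookup s (a ↑ˡ k)) (lookup s (opposite (lookup τ a ↑ˡ k))))

Avoids : ∀ {m k} → (Fin m → Fin m → Set) → Pattern k → Set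
Avoids {m} {k} Arc τ = ∀ (s : Vec (Fin m) (k + k)) → ¬ Occurs Arc τ s

Avoids? : ∀ {m k} (Arc : Fin m → Fin m → Set) → (∀ i j → Dec (Arc i j)) →
          (τ : Pattern k) → Dec (Avoids Arc τ)
Avoids? {k = k} Arc Arc? τ = allVec? (k + k) (λ s → ¬? (occ? s))
  where
  occ? : ∀ s → Dec (Occurs Arc τ s)
  occ? s = all? (λ a → all? (λ b → (a Fin.<? b) →-dec (lookup s a Fin.<? lookup s b)))
           ×-dec all? (λ a → Arc? _ _)

-- Perfect matchings of [m] (m = 2n), encoded by the partner map
-- v : Vec (Fin m) m, a fixed-point-free involution; M = {(i, v i) : i < v i}.

IsMatching : ∀ {m} → Vec (Fin m) m → Set
IsMatching v = ∀ i → (lookup v (lookup v i) ≡ i) × (lookup v i ≢ i)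

IsMatching? : ∀ {m} (v : Vec (Fin m) m) → Dec (IsMatching v)
IsMatching? v = all? (λ i → (lookup v (lookup v i) ≟ᶠ i) ×-dec ¬? (lookup v i ≟ᶠ i))

MArc : ∀ {m} → Vec (Fin m) m → Fin m → Fin m → Set
MArc v i j = (i Fin.< j) × (lookup v i ≡ j)

MArc? : ∀ {m} (v : Vec (Fin m) m) → ∀ i j → Dec (MArc v i j)
MArc? v i j = (i Fin.<? j) ×-dec (lookup v i ≟ᶠ j)

-- shape word: true = opener (east step), false = closer (south step)
shape : ∀ {m} → Vec (Fin m) m → Vec Bool m
shape v = tabulate (λ i → ⌊ i Fin.<? lookup v i ⌋)

MF? : ∀ {m} (w : Vec Bool m) (σ τ : Pattern 3) (v : Vec (Fin m) m) →
      Dec (IsMatching v × shape v ≡ w × Avoids (MArc v) σ × Avoids (MArc v) τ)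
MF? w σ τ v = IsMatching? v ×-dec ≡-dec _≟ᵇ_ (shape v) w
              ×-dec Avoids? (MArc v) (MArc? v) σ ×-dec Avoids? (MArc v) (MArc? v) τ

-- |M_F(σ,τ)| for the board F with border word w of length 2n
#MF : (n : ℕ) → Vec Bool (2 * n) → Pattern 3 → Pattern 3 → ℕ
#MF n w σ τ = countVec sumFin (2 * n) (MF? w σ τ)

Mn? : ∀ {m} (σ τ : Pattern 3) (v : Vec (Fin m) m) →
      Dec (IsMatching v × Avoids (MArc v) σ × Avoids (MArc v) τ)
Mn? σ τ v = IsMatching? v ×-dec Avoids? (MArc v) (MArc? v) σ ×-dec Avoids? (MArc v) (MArc? v) τ

#Mn : ℕ → Pattern 3 → Pattern 3 → ℕ
#Mn n σ τ = countVec sumFin (2 * n) (Mn? σ τ)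

step : Bool → ℤ → ℤ
step true  h = h ℤ.+ + 1
step false h = h ℤ.- + 1

heightsFrom : ∀ {m} → ℤ → Vec Bool m → Vec ℤ (suc m)
heightsFrom h []       = h ∷ []
heightsFrom h (b ∷ w)  = h ∷ heightsFrom (step b h) w

heights : ∀ {m} → Vec Bool m → Vec ℤ (suc m)
heights = heightsFrom (+ 0)

IsDyck : ∀ {m} → Vec Bool m → Set
IsDyck w = (∀ i → + 0 ℤ.≤ lookup (heights w) i) × (last (heights w) ≡ + 0)

height : ∀ {m} → Vec Bool m → ℤ
height w = foldr₁ _⊔_ (heights w)

η : ∀ {m} → Vec Bool m → ℕ
η w = count (ℤ._≟ + 2) (heights w)

-- Set partitions of [n], encoded as equivalence relations R (n×n Bool matrix)

Rel : ℕ → Set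
Rel n = Vec (Vec Bool n) n

_∼[_]_ : ∀ {n} → Fin n → Rel n → Fin n → Set
i ∼[ R ] j = lookup (lookup R i) j ≡ true

IsPartition : ∀ {n} → Rel n → Set
IsPartition R = (∀ i → i ∼[ R ] i) × (∀ i j → i ∼[ R ] j → j ∼[ R ] i)
              × (∀ i j k → i ∼[ R ] j → j ∼[ R ] k → i ∼[ R ] k)

PArc : ∀ {n} → Rel n → Fin n → Fin n → Set
PArc R i j = (i Fin.< j) × (i ∼[ R ] j) ×
             (∀ k → i Fin.< k → k Fin.< j → ¬ (i ∼[ R ] k))

private
  rel? : ∀ {n} (R : Rel n) i j → Dec (i ∼[ R ] j)
  rel? R i j = lookup (lookup R i) j ≟ᵇ true

IsPartition? : ∀ {n} (R : Rel n) → Dec (IsPartition R)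
IsPartition? R = all? (λ i → rel? R i i)
  ×-dec all? (λ i → all? λ j → rel? R i j →-dec rel? R j i)
  ×-dec all? (λ i → all? λ j → all? λ k → rel? R i j →-dec (rel? R j k →-dec rel? R i k))

PArc? : ∀ {n} (R : Rel n) → ∀ i j → Dec (PArc R i j)
PArc? R i j = (i Fin.<? j) ×-dec rel? R i j ×-dec
  all? (λ k → (i Fin.<? k) →-dec ((k Fin.<? j) →-dec ¬? (rel? R i k)))

Pn? : ∀ {n} (σ τ : Pattern 3) (R : Rel n) →
      Dec (IsPartition R × Avoids (PArc R) σ × Avoids (PArc R) τ)
Pn? σ τ R = IsPartition? R ×-dec Avoids? (PArc R) (PArc? R) σ ×-dec Avoids? (PArc R) (PArc? R) τ

#Pn : ℕ → Pattern 3 → Pattern 3 → ℕ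
#Pn n σ τ = countVec (sumVec sumBool n) n (Pn? σ τ)

Series : Set
Series = ℕ → ℤ

poly : Data.List.List ℤ → Series
poly Data.List.[] n = + 0
poly (c Data.List.∷ cs) zero = c
poly (c Data.List.∷ cs) (suc n) = poly cs n

sumUpTo : ℕ → (ℕ → ℤ) → ℤ
sumUpTo zero    f = f 0
sumUpTo (suc n) f = sumUpTo n f ℤ.+ f (suc n)

_⊛_ : Series → Series → Series
(f ⊛ g) n = sumUpTo n (λ k → f k ℤ.* g (n ℕ.∸ k))

ogf : (ℕ → ℕ) → Series
ogf a n = + a n

{-# OPTIONS --safe #-}
-- Read a diagram from left to right, keeping the list of open arcs. For a pair of open arcs the past
-- matters only in two ways: some completed arc crosses both, and then the later arc must be closed
-- first (no three mutually crossing arcs), or some completed arc lies below both, and then the earlier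
-- one must be closed first (no three nested arcs). By Erdős–Szekeres five arcs are never open together,
-- so only finitely many patterns of such constraints can still be completed. A pattern on h open arcs
-- has weight 2 if h ≥ 2 and there are no constraints, and weight 1 otherwise; the number of completions
-- is this weight times a number depending only on h and on the types of the remaining slots, and each
-- later visit to height 2 doubles it. Matchings and partitions are both read in this way, a partition
-- after splitting every vertex into the end of an arc followed by the start of an arc, and the two
-- series follow from the 5 × 5 transfer matrices over the heights 0 … 4.
module Submission where

open import Defs
open import Data.Bool using (Bool; true; false; if_then_else_; T; _∧_; not)
open import Data.Bool.Properties using () renaming (_≟_ to _≟ᵇ_)
open import Data.Empty using (⊥; ⊥-elim)
open import Data.Fin as Fin using (Fin; toℕ; fromℕ<)
open import Data.Fin.Properties using (toℕ-injective; toℕ<n; toℕ-fromℕ<; fromℕ<-toℕ; any?)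
  renaming (_≟_ to _≟ᶠ_)
open import Data.Integer as ℤ using (ℤ; +_; -_; -[1+_]) renaming (_<_ to _<ℤ_)
import Data.Integer.Properties as ℤ
import Data.Integer.Tactic.RingSolver as ℤ-Solver
open import Data.List using (List; []; _∷_; _++_; length)
open import Data.List.Membership.Propositional using (_∈_)
open import Data.List.Membership.Propositional.Properties using (∈-++⁺ˡ; ∈-++⁺ʳ; ∈-++⁻)
open import Data.List.Properties using (length-++)
open import Data.List.Relation.Unary.All as All using ([]; _∷_)
open import Data.List.Relation.Unary.AllPairs using ([]; _∷_)
open import Data.List.Relation.Unary.Any using (here; there)
open import Data.List.Relation.Unary.Unique.Propositional using (Unique)
import Data.List.Relation.Unary.Unique.Propositional.Properties as Unique
open import Data.Nat as ℕ using (ℕ; zero; suc; _*_; _+_; _∸_; _^_; _≤_; _<_; z≤n; s≤s; z<s; _≟_; _<?_)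
open import Data.Nat.DivMod using (_/_; m*n/n≡m)
open import Data.Nat.Properties
open import Data.Nat.Tactic.RingSolver using (solve-∀)
open import Data.Product using (Σ; ∃; _×_; _,_; proj₁; proj₂)
open import Data.Sum using (_⊎_; inj₁; inj₂; [_,_]; swap)
open import Data.Unit using (⊤; tt)
open import Data.Vec using (Vec; []; _∷_; lookup; tabulate; _∷ʳ_; removeAt; replicate)
import Data.Vec as Vec
open import Data.Vec.Properties using (≡-dec; lookup∘tabulate; lookup-map; lookup-replicate)
open import Function using (_∘_; id)
open import Relation.Binary.Definitions using (DecidableEquality; Tri; tri<; tri≈; tri>)
open import Relation.Binary.PropositionalEquality
  using (_≡_; _≢_; refl; sym; trans; cong; cong₂; subst; subst₂; module ≡-Reasoning)
open import Relation.Nullary using (Dec; yes; no; ¬_)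
open import Relation.Nullary.Decidable using (⌊_⌋; _×-dec_)
open import Data.Vec.Membership.Propositional using () renaming (_∈_ to _∈ᵥ_)
open import Data.Vec.Membership.Propositional.Properties using (∈-lookup)
open import Data.Vec.Membership.DecPropositional _≟_ using () renaming (_∈?_ to _∈ᵥ?_)
open import Data.Vec.Relation.Unary.Any using (here; there; index)
open import Data.Vec.Relation.Unary.Any.Properties using (lookup-index)

-- The weights form a common eigenvector. Summed over the admissible closings of a state, the
-- weights of its successors are its own weight times a factor that depends only on the height
-- (`closing-weight`), and openings behave likewise (`opening`). The factor is 2 exactly when height
-- 2 is entered, so only the height has to be remembered. Closings after which the constraints can
-- no longer all be met are discarded at once, which leaves thirteen kinds of state, up to the
-- nesting flag of the first slot.
--
-- The counts in the statement are sums of indicators over all vectors and have no recursive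
-- structure. They are replaced by duplicate-free exhaustive lists, which can be split according to
-- the type of the next slot. Diagrams are involutions of ℕ whose unmatched slots are fixed points,
-- and a `Policy` for each slot says whether it may close an arc, stay unmatched or open an arc.
-- Matchings of a given shape, all matchings, and partitions are then instances of one enumeration;
-- they differ only in their policies.

-- Finite sums and counting by exhaustive lists

record Summation {A : Set} (S : (A → ℕ) → ℕ) : Set where
  field
    S-cong  : ∀ {f g} → (∀ x → f x ≡ g x) → S f ≡ S g
    S-zero  : S (λ _ → 0) ≡ 0
    S-+     : ∀ f g → S (λ x → f x + g x) ≡ S f + S g
    S-point : ∀ a f → (∀ x → x ≢ a → f x ≡ 0) → S f ≡ f a

open Summation

+-interchange : ∀ a b c d → (a + b) + (c + d) ≡ (a + c) + (b + d)
+-interchange = solve-∀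

sumFin-cong : ∀ {m} {f g : Fin m → ℕ} → (∀ x → f x ≡ g x) → sumFin f ≡ sumFin g
sumFin-cong {zero}  e = refl
sumFin-cong {suc m} e = cong₂ _+_ (e Fin.zero) (sumFin-cong (e ∘ Fin.suc))

sumFin-zero : ∀ m → sumFin {m} (λ _ → 0) ≡ 0
sumFin-zero zero    = refl
sumFin-zero (suc m) = sumFin-zero m

sumFin-+ : ∀ {m} (f g : Fin m → ℕ) → sumFin (λ x → f x + g x) ≡ sumFin f + sumFin g
sumFin-+ {zero}  f g = refl
sumFin-+ {suc m} f g = trans (cong (λ n → f Fin.zero + g Fin.zero + n) (sumFin-+ (f ∘ Fin.suc) (g ∘ Fin.suc)))
                             (+-interchange (f Fin.zero) (g Fin.zero) _ _)

sumFin-point : ∀ {m} (a : Fin m) f → (∀ x → x ≢ a → f x ≡ 0) → sumFin f ≡ f a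
sumFin-point {suc m} Fin.zero f off =
  trans (cong (λ n → f Fin.zero + n)
          (trans (sumFin-cong (λ x → off (Fin.suc x) λ ())) (sumFin-zero m)))
        (+-identityʳ _)
sumFin-point (Fin.suc a) f off =
  cong₂ _+_ (off Fin.zero λ ())
            (sumFin-point a (f ∘ Fin.suc) (λ x x≢a → off (Fin.suc x) λ { refl → x≢a refl }))

sumFin-summation : ∀ {m} → Summation (sumFin {m})
sumFin-summation {m} = record
  { S-cong = sumFin-cong ; S-zero = sumFin-zero m ; S-+ = sumFin-+ ; S-point = sumFin-point }

sumBool-summation : Summation sumBool
sumBool-summation = record
  { S-cong = λ e → cong₂ _+_ (e false) (e true)
  ; S-zero = refl
  ; S-+ = λ f g → +-interchange (f false) (g false) (f true) (g true)
  ; S-point = λ { false f off → trans (cong (λ n → f false + n) (off true λ ())) (+-identityʳ _)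
                ; true  f off → cong (_+ f true) (off false λ ()) } }

sumVec-summation : ∀ {A : Set} {S : (A → ℕ) → ℕ} → Summation S → ∀ j → Summation (sumVec S j)
sumVec-summation {A} {S} Σ-S zero = record
  { S-cong = λ e → e []
  ; S-zero = refl
  ; S-+ = λ _ _ → refl
  ; S-point = λ { [] _ _ → refl } }
sumVec-summation {A} {S} Σ-S (suc j) = record
  { S-cong = λ e → S-cong Σ-S (λ x → S-cong rec (λ t → e (x ∷ t)))
  ; S-zero = trans (S-cong Σ-S (λ _ → S-zero rec)) (S-zero Σ-S)
  ; S-+ = λ f g → trans (S-cong Σ-S (λ x → S-+ rec (f ∘ (x ∷_)) (g ∘ (x ∷_)))) (S-+ Σ-S _ _)
  ; S-point = point }
  where
  rec = sumVec-summation Σ-S j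
  point : ∀ a f → (∀ x → x ≢ a → f x ≡ 0) → sumVec S (suc j) f ≡ f a
  point (a ∷ as) f off = trans
    (S-point Σ-S a _ (λ x x≢a →
      trans (S-cong rec (λ t → off (x ∷ t) λ { refl → x≢a refl })) (S-zero rec)))
    (S-point rec as _ (λ t t≢as → off (a ∷ t) λ { refl → t≢as refl }))

infix 4 _HasSize_
record _HasSize_ {A : Set} (P : A → Set) (n : ℕ) : Set where
  constructor enumeration
  field
    elems    : List A
    unique   : Unique elems
    sound    : ∀ {a} → a ∈ elems → P a
    complete : ∀ {a} → P a → a ∈ elems
    size     : length elems ≡ n

open _HasSize_

size-empty : ∀ {A : Set} {P : A → Set} → (∀ {a} → ¬ P a) → P HasSize 0
size-empty none = enumeration [] [] (λ ()) (⊥-elim ∘ none) refl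

size-singleton : ∀ {A : Set} {P : A → Set} a → P a → (∀ {b} → P b → b ≡ a) → P HasSize 1
size-singleton a pa only =
  enumeration (a ∷ []) ([] ∷ []) (λ { (here refl) → pa }) (here ∘ only) refl

size-⇔ : ∀ {A : Set} {P Q : A → Set} {n} →
         (∀ {a} → P a → Q a) → (∀ {a} → Q a → P a) → P HasSize n → Q HasSize n
size-⇔ to from p = enumeration (elems p) (unique p) (to ∘ sound p) (complete p ∘ from) (size p)

size-⊎ : ∀ {A : Set} {P Q : A → Set} {m n} → (∀ {a} → P a → Q a → ⊥) →
         P HasSize m → Q HasSize n → (λ a → P a ⊎ Q a) HasSize (m + n)
size-⊎ {P = P} {Q} disjoint p q = enumeration (elems p ++ elems q)
  (Unique.++⁺ (unique p) (unique q) (λ (a∈p , a∈q) → disjoint (sound p a∈p) (sound q a∈q)))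
  snd cmp
  (trans (length-++ (elems p)) (cong₂ _+_ (size p) (size q)))
  where
  snd : ∀ {a} → a ∈ elems p ++ elems q → P a ⊎ Q a
  snd a∈ with ∈-++⁻ (elems p) a∈
  ... | inj₁ a∈p = inj₁ (sound p a∈p)
  ... | inj₂ a∈q = inj₂ (sound q a∈q)
  cmp : ∀ {a} → P a ⊎ Q a → a ∈ elems p ++ elems q
  cmp (inj₁ pa) = ∈-++⁺ˡ (complete p pa)
  cmp (inj₂ qa) = ∈-++⁺ʳ (elems p) (complete q qa)

size-∃Fin : ∀ {A : Set} {h} {P : Fin h → A → Set} {c : Fin h → ℕ} →
            (∀ {i j a} → P i a → P j a → i ≡ j) → (∀ i → P i HasSize c i) →
            (λ a → ∃ λ i → P i a) HasSize sumFin c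
size-∃Fin {h = zero}  disjoint p = size-empty λ ()
size-∃Fin {h = suc h} disjoint p = size-⇔
  (λ { (inj₁ pa) → Fin.zero , pa ; (inj₂ (i , pa)) → Fin.suc i , pa })
  (λ { (Fin.zero , pa) → inj₁ pa ; (Fin.suc i , pa) → inj₂ (i , pa) })
  (size-⊎ (λ { pa (i , qa) → case (disjoint pa qa) }) (p Fin.zero)
    (size-∃Fin (λ x y → suc-inj (disjoint x y)) (p ∘ Fin.suc)))
  where
  case : ∀ {i : Fin h} → Fin.zero ≡ Fin.suc i → ⊥
  case ()
  suc-inj : ∀ {i j : Fin h} → Fin.suc i ≡ Fin.suc j → i ≡ j
  suc-inj refl = refl

size-if : ∀ {A : Set} {P : A → Set} {n} b → (T b → P HasSize n) →
          (λ a → T b × P a) HasSize (if b then n else 0)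
size-if true  p = size-⇔ (tt ,_) proj₂ (p tt)
size-if false _ = size-empty proj₁

-- Induction on the list: `f` is split into its value at the head, which `S-point` evaluates, and
-- the rest, which is again an indicator, now of the tail, because the head does not recur.
S-indicator : ∀ {A : Set} {S : (A → ℕ) → ℕ} → Summation S → DecidableEquality A →
              ∀ {L : List A} → Unique L → ∀ f →
              (∀ {a} → a ∈ L → f a ≡ 1) → (∀ {a} → ¬ a ∈ L → f a ≡ 0) → S f ≡ length L
S-indicator Σ-S _≟ᴬ_ {[]} [] f one zer =
  trans (S-cong Σ-S (λ x → zer λ ())) (S-zero Σ-S)
S-indicator {A} {S} Σ-S _≟ᴬ_ {x ∷ L} (x∉L ∷ uniq) f one zer = begin
  S f                             ≡⟨ S-cong Σ-S split ⟩
  S (λ v → at v + off v)          ≡⟨ S-+ Σ-S at off ⟩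
  S at + S off                    ≡⟨ cong₂ _+_ at≡1 off≡L ⟩
  1 + length L                    ∎
  where
  open ≡-Reasoning
  at off : A → ℕ
  at v = if ⌊ v ≟ᴬ x ⌋ then f v else 0
  off v = if ⌊ v ≟ᴬ x ⌋ then 0 else f v
  split : ∀ v → f v ≡ at v + off v
  split v with v ≟ᴬ x
  ... | yes _ = sym (+-identityʳ _)
  ... | no _ = refl
  at-off : ∀ v → v ≢ x → at v ≡ 0
  at-off v v≢x with v ≟ᴬ x
  ... | yes v≡x = ⊥-elim (v≢x v≡x)
  ... | no _ = refl
  at-x : at x ≡ 1
  at-x with x ≟ᴬ x
  ... | yes _ = one (here refl)
  ... | no x≢x = ⊥-elim (x≢x refl)
  at≡1 : S at ≡ 1
  at≡1 = trans (S-point Σ-S x at at-off) at-x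
  off-∈ : ∀ {v} → v ∈ L → off v ≡ 1
  off-∈ {v} v∈L with v ≟ᴬ x
  ... | yes refl = ⊥-elim (All.lookup x∉L v∈L refl)
  ... | no _ = one (there v∈L)
  off-∉ : ∀ {v} → ¬ v ∈ L → off v ≡ 0
  off-∉ {v} v∉L with v ≟ᴬ x
  ... | yes _ = refl
  ... | no v≢x = zer λ { (here v≡x) → v≢x v≡x ; (there v∈L) → v∉L v∈L }
  off≡L : S off ≡ length L
  off≡L = S-indicator Σ-S _≟ᴬ_ uniq off off-∈ off-∉

countVec-size : ∀ {A : Set} {S : (A → ℕ) → ℕ} → Summation S → DecidableEquality A →
                ∀ {j n} {P : Vec A j → Set} (P? : ∀ v → Dec (P v)) → P HasSize n →
                countVec S j P? ≡ n
countVec-size {A} Σ-S _≟ᴬ_ {j} {P = P} P? p =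
  trans (S-indicator (sumVec-summation Σ-S j) (≡-dec _≟ᴬ_) (unique p) _
          (λ {v} v∈ → one v (sound p v∈)) (λ {v} v∉ → zer v (v∉ ∘ complete p)))
        (size p)
  where
  one : ∀ v → P v → (if ⌊ P? v ⌋ then 1 else 0) ≡ 1
  one v pv with P? v
  ... | yes _ = refl
  ... | no ¬pv = ⊥-elim (¬pv pv)
  zer : ∀ v → ¬ P v → (if ⌊ P? v ⌋ then 1 else 0) ≡ 0
  zer v ¬pv with P? v
  ... | yes pv = ⊥-elim (¬pv pv)
  ... | no _ = refl

-- Diagrams and the weighted number of completions

record Policy : Set where
  constructor policy
  field closer fixed opener : Bool

open Policy

Permits : Policy → ℕ → ℕ → Set
Permits π t y = (y < t → T (closer π)) × (y ≡ t → T (fixed π)) × (t < y → T (opener π))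

Conforms : ∀ {r} → ℕ → Vec Policy r → (ℕ → ℕ) → Set
Conforms t []       f = ⊤
Conforms t (π ∷ πs) f = Permits π t (f t) × Conforms (suc t) πs f

-- f is the partner map of a partial matching of the slots 0 … m−1; unmatched slots are fixed points.
record Diagram (m : ℕ) (f : ℕ → ℕ) : Set where
  field
    involutive : ∀ i → f (f i) ≡ i
    outside    : ∀ {i} → m ≤ i → f i ≡ i
    noCrossing : ∀ {a b c} → a < b → b < c → c < f a → f a < f b → f b < f c → ⊥
    noNesting  : ∀ {a b c} → a < b → b < c → c < f c → f c < f b → f b < f a → ⊥

  injective : ∀ {i j} → f i ≡ f j → i ≡ j
  injective {i} {j} e = trans (sym (involutive i)) (trans (cong f e) (involutive j))

  bounded : ∀ {i} → i < m → f i < m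
  bounded {i} i<m with m ℕ.≤? f i
  ... | no ≰ = ≰⇒> ≰
  ... | yes m≤ = ⊥-elim (<⇒≱ i<m (subst (m ≤_) (trans (sym (outside m≤)) (involutive i)) m≤))

-- The contributions of an opening and of a closing at height `h`. Entering height 2, from 1 or from
-- 3, brings the factor 2; the zeros exclude a fifth open arc and a closing when nothing is open.
upward downward : (ℕ → ℕ) → ℕ → ℕ
upward g 0 = g 1
upward g 1 = 2 * g 2
upward g 2 = g 3
upward g 3 = g 4
upward g (suc (suc (suc (suc _)))) = 0
downward g 1 = g 0
downward g 2 = g 1
downward g 3 = 2 * g 2
downward g 4 = g 3
downward g _ = 0

-- Up to the weight of the current state, the number of ways to complete a prefix with h open arcs.
completions : ∀ {r} → Vec Policy r → ℕ → ℕ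
completions []       zero    = 1
completions []       (suc _) = 0
completions (π ∷ πs) h =
  (if fixed π then completions πs h else 0)
  + ((if opener π then upward (completions πs) h else 0)
  + (if closer π then downward (completions πs) h else 0))

-- States: order constraints on the open slots

-- A false flag asserts the negation, since permission to close an arc has to be derived from the
-- flags as well as prohibition.
Holds : Bool → Set → Set
Holds true  P = P
Holds false P = ¬ P

Holds-⇔ : ∀ {P Q : Set} b → (P → Q) → (Q → P) → Holds b P → Holds b Q
Holds-⇔ true  to from p = to p
Holds-⇔ false to from ¬p = ¬p ∘ from

Holds-∧ : ∀ {P Q : Set} a b → Holds a P → Holds b Q → Holds (a ∧ b) (P × Q)
Holds-∧ true  true  p q = p , q
Holds-∧ true  false p ¬q = ¬q ∘ proj₂
Holds-∧ false _     ¬p _ = ¬p ∘ proj₁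

Holds-not : ∀ {P : Set} b → Holds b P → Holds (not b) (¬ P)
Holds-not true  p ¬p = ¬p p
Holds-not false ¬p = ¬p

-- Open slots x < y are Crossed if some arc completed so far crosses the future arcs of both; then the
-- arc of y must be closed before that of x. If y is Nested, a completed arc lies below the future arcs
-- of x and y, and the arc of x must be closed before that of y.
Crossed : (ℕ → ℕ) → ℕ → ℕ → Set
Crossed u x y = ∃ λ a → a < x × y < u a

Nested : (ℕ → ℕ) → ℕ → Set
Nested u y = ∃ λ a → y < a × a < u a

-- For each open slot: is it nested, and is it crossed together with each of the later open slots?
data Flags : ℕ → Set where
  []    : Flags 0
  entry : ∀ {h} → Bool → Vec Bool h → Flags h → Flags (suc h)

CrossedRow : ∀ {h} → (ℕ → ℕ) → ℕ → Vec Bool h → Vec ℕ h → Set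
CrossedRow u x []      []      = ⊤
CrossedRow u x (b ∷ r) (y ∷ O) = Holds b (Crossed u x y) × CrossedRow u x r O

Describes : ∀ {h} → (ℕ → ℕ) → Flags h → Vec ℕ h → Set
Describes u []            []      = ⊤
Describes u (entry n r F) (x ∷ O) = Holds n (Nested u x) × CrossedRow u x r O × Describes u F O

-- No completed arc reaches beyond the new slot, so every flag that involves it is false.
openLast : ∀ {h} → Flags h → Flags (suc h)
openLast []            = entry false [] []
openLast (entry n r F) = entry n (r ∷ʳ false) (openLast F)

allCrossed : ∀ {h} → Flags h → Flags h
allCrossed []            = []
allCrossed (entry n r F) = entry n (replicate _ true) (allCrossed F)

-- The newly completed arc crosses the future arcs of all open slots to the right of its start and
-- lies below those of the slots to its left. The crossings of a slot on the left and the nesting of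
-- a slot on the right stay as they were: the former need an arc that starts before the slot, the
-- latter one that starts after it.
close : ∀ {h} → Flags (suc h) → Fin (suc h) → Flags h
close (entry n r F)               Fin.zero    = allCrossed F
close (entry n r F@(entry _ _ _)) (Fin.suc p) = entry true (removeAt r p) (close F p)

none : ∀ {h} → Vec Bool h → Bool
none []      = true
none (b ∷ r) = not b ∧ none r

closableAfter : ∀ {h} → Flags h → Fin h → Bool
closableAfter (entry n r F) Fin.zero    = none r ∧ not n
closableAfter (entry n r F) (Fin.suc p) = closableAfter F p

-- The first open slot is never blocked by nestings, since these need an earlier open slot.
closable : ∀ {h} → Flags (suc h) → Fin (suc h) → Bool
closable (entry n r F) Fin.zero    = none r
closable (entry n r F) (Fin.suc p) = closableAfter F p

-- The flags that can still be completed to a diagram; the Boolean records the irrelevant nesting flag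
-- of the first open slot.
data Kind : ℕ → Set where
  k0                  : Kind 0
  k1                  : Bool → Kind 1
  f2 x12 n12          : Bool → Kind 2
  f3 x12f n12f x23    : Bool → Kind 3
  f4 x12ff n12ff x23f : Bool → Kind 4

-- In the names, `x12` means that the open slots 1 and 2 are crossed, `n12` that slot 2 is nested
-- and so has to wait for slot 1; a trailing `f` is a free slot opened afterwards, and `f2`, `f3`,
-- `f4` are entirely free.
flags : ∀ {h} → Kind h → Flags h
flags k0        = []
flags (k1 b)    = entry b [] []
flags (f2 b)    = openLast (flags (k1 b))
flags (x12 b)   = entry b (true ∷ []) (entry false [] [])
flags (n12 b)   = entry b (false ∷ []) (entry true [] [])
flags (f3 b)    = openLast (flags (f2 b))
flags (x12f b)  = openLast (flags (x12 b))
flags (n12f b)  = openLast (flags (n12 b))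
flags (x23 b)   = entry b (false ∷ false ∷ []) (entry false (true ∷ []) (entry false [] []))
flags (f4 b)    = openLast (flags (f3 b))
flags (x12ff b) = openLast (flags (x12f b))
flags (n12ff b) = openLast (flags (n12f b))
flags (x23f b)  = openLast (flags (x23 b))

weight : ∀ {h} → Kind h → ℕ
weight (f2 _) = 2
weight (f3 _) = 2
weight (f4 _) = 2
weight _      = 1

-- In a `conflict` the second slot must be closed both before and after the first. In the other two
-- cases the forced order of closing itself produces three nested arcs (`crossings`) or three
-- mutually crossing arcs (`nestings`).
data Doomed : ∀ {h} → Flags h → Set where
  conflict  : ∀ {h n r r′} {F : Flags h} → Doomed (entry n (true ∷ r) (entry true r′ F))
  crossings : ∀ {h n n′ r r′} {F : Flags (suc h)} → Doomed (entry n (true ∷ r) (entry n′ (true ∷ r′) F))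
  nestings  : ∀ {h n r r′ r″} {F : Flags h} → Doomed (entry n r (entry true r′ (entry true r″ F)))

data Move {h} (F : Flags (suc h)) (p : Fin (suc h)) : Set where
  to      : (k : Kind h) → closable F p ≡ true → close F p ≡ flags k → Move F p
  blocked : closable F p ≡ false → Move F p
  doomed  : Doomed (close F p) → Move F p

pattern #0 = Fin.zero
pattern #1 = Fin.suc Fin.zero
pattern #2 = Fin.suc #1
pattern #3 = Fin.suc #2
pattern #4 = Fin.suc #3
pattern #5 = Fin.suc #4

-- Every case is settled by evaluating the flags. With four free slots, closing the first leaves
-- three pairwise crossed slots and closing the last leaves three nested ones; at height 4 only the
-- two middle closings can survive.
move : ∀ {h} (k : Kind (suc h)) p → Move (flags k) p
move (k1 b)    #0 = to k0 refl refl
move (f2 b)    #0 = to (k1 false) refl refl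
move (f2 b)    #1 = to (k1 true) refl refl
move (x12 b)   #0 = blocked refl
move (x12 b)   #1 = to (k1 true) refl refl
move (n12 b)   #0 = to (k1 true) refl refl
move (n12 b)   #1 = blocked refl
move (f3 b)    #0 = to (x12 false) refl refl
move (f3 b)    #1 = to (f2 true) refl refl
move (f3 b)    #2 = to (n12 true) refl refl
move (x12f b)  #0 = blocked refl
move (x12f b)  #1 = to (f2 true) refl refl
move (x12f b)  #2 = doomed conflict
move (n12f b)  #0 = to (x12 true) refl refl
move (n12f b)  #1 = blocked refl
move (n12f b)  #2 = to (n12 true) refl refl
move (x23 b)   #0 = to (x12 false) refl refl
move (x23 b)   #1 = blocked refl
move (x23 b)   #2 = to (n12 true) refl refl
move (f4 b)    #0 = doomed crossings
move (f4 b)    #1 = to (x23 true) refl refl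
move (f4 b)    #2 = to (n12f true) refl refl
move (f4 b)    #3 = doomed nestings
move (x12ff b) #0 = blocked refl
move (x12ff b) #1 = to (x23 true) refl refl
move (x12ff b) #2 = doomed conflict
move (x12ff b) #3 = doomed conflict
move (n12ff b) #0 = doomed crossings
move (n12ff b) #1 = blocked refl
move (n12ff b) #2 = to (n12f true) refl refl
move (n12ff b) #3 = doomed nestings
move (x23f b)  #0 = doomed crossings
move (x23f b)  #1 = blocked refl
move (x23f b)  #2 = to (n12f true) refl refl
move (x23f b)  #3 = doomed nestings

moveWeight : ∀ {h} {F : Flags (suc h)} {p} → Move F p → ℕ
moveWeight (to k _ _)  = weight k
moveWeight (blocked _) = 0
moveWeight (doomed _)  = 0

-- At heights 2 and 4 a free kind has two surviving closings of weight 1 and a constrained kind has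
-- one. At height 3 the totals are 4 for the free kind and 2 for each constrained one, whence the
-- factor 2 in `downward`.
closing-weight : ∀ {h} (k : Kind (suc h)) g →
                 sumFin (λ p → moveWeight (move k p) * g h) ≡ weight k * downward g (suc h)
closing-weight (k1 b)    g = +-identityʳ _
closing-weight (f2 b)    g = solution (g 1) where
  solution : ∀ x → 1 * x + (1 * x + 0) ≡ 2 * x
  solution = solve-∀
closing-weight (x12 b)   g = +-identityʳ _
closing-weight (n12 b)   g = +-identityʳ _
closing-weight (f3 b)    g = solution (g 2) where
  solution : ∀ x → 1 * x + (2 * x + (1 * x + 0)) ≡ 2 * (2 * x)
  solution = solve-∀
closing-weight (x12f b)  g = solution (g 2) where
  solution : ∀ x → 2 * x + 0 ≡ 1 * (2 * x)
  solution = solve-∀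
closing-weight (n12f b)  g = solution (g 2) where
  solution : ∀ x → 1 * x + (1 * x + 0) ≡ 1 * (2 * x)
  solution = solve-∀
closing-weight (x23 b)   g = solution (g 2) where
  solution : ∀ x → 1 * x + (1 * x + 0) ≡ 1 * (2 * x)
  solution = solve-∀
closing-weight (f4 b)    g = solution (g 3) where
  solution : ∀ x → 1 * x + (1 * x + 0) ≡ 2 * x
  solution = solve-∀
closing-weight (x12ff b) g = +-identityʳ _
closing-weight (n12ff b) g = +-identityʳ _
closing-weight (x23f b)  g = +-identityʳ _

-- A new slot brings no constraint, so the weight changes only from height 1 to height 2, where a
-- choice of order first appears. Height 4 is set apart because a fifth open arc is impossible.
opening : ∀ {h} (k : Kind h) →
          (Σ (Kind (suc h)) λ k′ → openLast (flags k) ≡ flags k′ ×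
             (∀ g → weight k′ * g (suc h) ≡ weight k * upward g h))
          ⊎ h ≡ 4
opening k0        = inj₁ (k1 false , refl , λ g → refl)
opening (k1 b)    = inj₁ (f2 b , refl , λ g → sym (+-identityʳ _))
opening (f2 b)    = inj₁ (f3 b , refl , λ g → refl)
opening (x12 b)   = inj₁ (x12f b , refl , λ g → refl)
opening (n12 b)   = inj₁ (n12f b , refl , λ g → refl)
opening (f3 b)    = inj₁ (f4 b , refl , λ g → refl)
opening (x12f b)  = inj₁ (x12ff b , refl , λ g → refl)
opening (n12f b)  = inj₁ (n12ff b , refl , λ g → refl)
opening (x23 b)   = inj₁ (x23f b , refl , λ g → refl)
opening (f4 b)    = inj₂ refl
opening (x12ff b) = inj₂ refl
opening (n12ff b) = inj₂ refl
opening (x23f b)  = inj₂ refl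

-- Prefixes of a diagram and the diagrams that extend them

Sorted : ∀ {h} → Vec ℕ h → Set
Sorted []      = ⊤
Sorted (x ∷ O) = (∀ {y} → y ∈ᵥ O → x < y) × Sorted O

∈-∷ʳ⁻ : ∀ {h t x} (O : Vec ℕ h) → x ∈ᵥ (O ∷ʳ t) → x ∈ᵥ O ⊎ x ≡ t
∈-∷ʳ⁻ []      (here e) = inj₂ e
∈-∷ʳ⁻ (y ∷ O) (here e) = inj₁ (here e)
∈-∷ʳ⁻ (y ∷ O) (there x∈) with ∈-∷ʳ⁻ O x∈
... | inj₁ x∈O = inj₁ (there x∈O)
... | inj₂ e   = inj₂ e

Sorted-∷ʳ : ∀ {h t} {O : Vec ℕ h} → Sorted O → (∀ {x} → x ∈ᵥ O → x < t) → Sorted (O ∷ʳ t)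
Sorted-∷ʳ {O = []}    _ _ = (λ ()) , tt
Sorted-∷ʳ {O = x ∷ O} (x< , s) O<t =
  (λ y∈ → case (∈-∷ʳ⁻ O y∈)) , Sorted-∷ʳ s (O<t ∘ there)
  where
  case : ∀ {y} → y ∈ᵥ O ⊎ y ≡ _ → x < y
  case (inj₁ y∈O) = x< y∈O
  case (inj₂ refl) = O<t (here refl)

∈-∷ʳ⁺ : ∀ {h t x} (O : Vec ℕ h) → x ∈ᵥ O → x ∈ᵥ (O ∷ʳ t)
∈-∷ʳ⁺ (y ∷ O) (here e)   = here e
∈-∷ʳ⁺ (y ∷ O) (there x∈) = there (∈-∷ʳ⁺ O x∈)

last-∈ : ∀ {h t} (O : Vec ℕ h) → t ∈ᵥ (O ∷ʳ t)
last-∈ []      = here refl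
last-∈ (y ∷ O) = there (last-∈ O)

∈-removeAt⁻ : ∀ {h x} (O : Vec ℕ (suc h)) p → x ∈ᵥ removeAt O p → x ∈ᵥ O
∈-removeAt⁻ (y ∷ O)         Fin.zero    x∈ = there x∈
∈-removeAt⁻ (y ∷ O@(_ ∷ _)) (Fin.suc p) (here e) = here e
∈-removeAt⁻ (y ∷ O@(_ ∷ _)) (Fin.suc p) (there x∈) = there (∈-removeAt⁻ O p x∈)

∈-removeAt⁺ : ∀ {h x} (O : Vec ℕ (suc h)) p → x ∈ᵥ O → x ≢ lookup O p → x ∈ᵥ removeAt O p
∈-removeAt⁺ (y ∷ O)         Fin.zero    (here e)   x≢ = ⊥-elim (x≢ e)
∈-removeAt⁺ (y ∷ O)         Fin.zero    (there x∈) x≢ = x∈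
∈-removeAt⁺ (y ∷ O@(_ ∷ _)) (Fin.suc p) (here e)   x≢ = here e
∈-removeAt⁺ (y ∷ O@(_ ∷ _)) (Fin.suc p) (there x∈) x≢ = there (∈-removeAt⁺ O p x∈ x≢)

∈-removeAt-≢ : ∀ {h x} (O : Vec ℕ (suc h)) p → Sorted O → x ∈ᵥ removeAt O p → x ≢ lookup O p
∈-removeAt-≢ (y ∷ O)         Fin.zero    (y< , s) x∈ refl = <-irrefl refl (y< x∈)
∈-removeAt-≢ (y ∷ O@(_ ∷ _)) (Fin.suc p) (y< , s) (here refl) e = <-irrefl e (y< (∈-lookup p O))
∈-removeAt-≢ (y ∷ O@(_ ∷ _)) (Fin.suc p) (y< , s) (there x∈)  e = ∈-removeAt-≢ O p s x∈ e

Sorted-removeAt : ∀ {h} (O : Vec ℕ (suc h)) p → Sorted O → Sorted (removeAt O p)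
Sorted-removeAt (y ∷ O)         Fin.zero    (y< , s) = s
Sorted-removeAt (y ∷ O@(_ ∷ _)) (Fin.suc p) (y< , s) =
  (λ x∈ → y< (∈-removeAt⁻ O p x∈)) , Sorted-removeAt O p s

Sorted-lookup-injective : ∀ {h} (O : Vec ℕ h) → Sorted O → ∀ {p q} → lookup O p ≡ lookup O q → p ≡ q
Sorted-lookup-injective (x ∷ O) _ {Fin.zero} {Fin.zero} e = refl
Sorted-lookup-injective (x ∷ O) (x< , s) {Fin.zero} {Fin.suc q} e = ⊥-elim (<-irrefl e (x< (∈-lookup q O)))
Sorted-lookup-injective (x ∷ O) (x< , s) {Fin.suc p} {Fin.zero} e = ⊥-elim (<-irrefl (sym e) (x< (∈-lookup p O)))
Sorted-lookup-injective (x ∷ O) (x< , s) {Fin.suc p} {Fin.suc q} e = cong Fin.suc (Sorted-lookup-injective O s e)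

-- The prefix of length t of a diagram: u matches the completed arcs and fixes everything else, O lists
-- the slots whose arcs are still open. Open arcs count as ending after all completed ones.
record Prefix (t : ℕ) {h} (O : Vec ℕ h) (u : ℕ → ℕ) : Set where
  field
    sorted     : Sorted O
    below      : ∀ {i} → i ∈ᵥ O → i < t
    involutive : ∀ i → u (u i) ≡ i
    beyond     : ∀ {i} → t ≤ i → u i ≡ i
    open-fixed : ∀ {i} → i ∈ᵥ O → u i ≡ i
    noCrossing : ∀ {a b c} → a < b → b < c → c < u a → u a < u b → c ∈ᵥ O ⊎ u b < u c → ⊥
    noNesting  : ∀ {a b c} → a < b → b < c → c < u c → u c < u b → a ∈ᵥ O ⊎ u b < u a → ⊥

  bounded : ∀ {i} → i < t → u i < t
  bounded {i} i<t with t ℕ.≤? u i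
  ... | no ≰ = ≰⇒> ≰
  ... | yes t≤ = ⊥-elim (<⇒≱ i<t (subst (t ≤_) (trans (sym (beyond t≤)) (involutive i)) t≤))

  arc-start : ∀ {a} → a < u a → a < t
  arc-start {a} a<ua with t ℕ.≤? a
  ... | no ≰ = ≰⇒> ≰
  ... | yes t≤ = ⊥-elim (<-irrefl (sym (beyond t≤)) a<ua)

  arc-end : ∀ {a} → a < u a → u a < t
  arc-end a<ua = bounded (arc-start a<ua)

  arc-closed : ∀ {a} → a < u a → ¬ a ∈ᵥ O
  arc-closed a<ua a∈O = <-irrefl (sym (open-fixed a∈O)) a<ua

record Extends (t : ℕ) {h} (O : Vec ℕ h) (u f : ℕ → ℕ) : Set where
  field
    agrees : ∀ {i} → i < t → ¬ i ∈ᵥ O → f i ≡ u i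
    later  : ∀ {i} → i ∈ᵥ O → t ≤ f i

module _ {m t h} {O : Vec ℕ h} {u f : ℕ → ℕ}
         (D : Diagram m f) (U : Prefix t O u) (E : Extends t O u f) where
  private
    module D = Diagram D
    module U = Prefix U
  open Extends E

  arc-agrees : ∀ {a} → a < u a → f a ≡ u a
  arc-agrees a<ua = agrees (U.arc-start a<ua) (U.arc-closed a<ua)

  open-compare : ∀ {x y} → x < y → f x < f y ⊎ f y < f x
  open-compare {x} {y} x<y with <-cmp (f x) (f y)
  ... | tri< lt _ _ = inj₁ lt
  ... | tri≈ _ e _  = ⊥-elim (<-irrefl (D.injective e) x<y)
  ... | tri> _ _ gt = inj₂ gt

  -- The completed arc from `a` ends before `t`, hence before `f x`; if `f x < f y`, it would form
  -- three mutually crossing arcs with those of `x` and `y`.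
  crossed⇒decreasing : ∀ {x y} → x ∈ᵥ O → x < y → Crossed u x y → ¬ f x < f y
  crossed⇒decreasing {x} x∈O x<y (a , a<x , y<ua) fx<fy =
    D.noCrossing a<x x<y (subst (_ <_) (sym fa) y<ua) fa<fx fx<fy
    where
    a<ua = <-trans a<x (<-trans x<y y<ua)
    fa = arc-agrees a<ua
    fa<fx : f a < f x
    fa<fx = subst (_< f x) (sym fa) (<-≤-trans (U.arc-end a<ua) (later x∈O))

  nested⇒increasing : ∀ {x y} → y ∈ᵥ O → x < y → Nested u y → ¬ f y < f x
  nested⇒increasing {x} {y} y∈O x<y (a , y<a , a<ua) fy<fx =
    D.noNesting x<y y<a (subst (a <_) (sym fa) a<ua)
      (subst (_< f y) (sym fa) (<-≤-trans (U.arc-end a<ua) (later y∈O))) fy<fx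
    where
    fa = arc-agrees a<ua

  -- Open slots lie before `t` and their partners do not, so the overlap `z < f x` required of a
  -- triple crossing is automatic.
  no-increasing : ∀ {x y z} → x ∈ᵥ O → z ∈ᵥ O → x < y → y < z → f x < f y → ¬ f y < f z
  no-increasing x∈O z∈O x<y y<z = D.noCrossing x<y y<z (<-≤-trans (U.below z∈O) (later x∈O))

  no-decreasing : ∀ {x y z} → z ∈ᵥ O → x < y → y < z → f y < f x → ¬ f z < f y
  no-decreasing z∈O x<y y<z fy<fx fz<fy =
    D.noNesting x<y y<z (<-≤-trans (U.below z∈O) (later z∈O)) fz<fy fy<fx

  doomed-absurd : ∀ {F : Flags h} → Doomed F → ¬ Describes u F O
  doomed-absurd conflict d = go O id U.sorted d
    where
    go : ∀ {h n r r′} {F : Flags h} (O′ : Vec ℕ (suc (suc h))) → (∀ {i} → i ∈ᵥ O′ → i ∈ᵥ O) → Sorted O′ →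
         ¬ Describes u (entry n (true ∷ r) (entry true r′ F)) O′
    go (x ∷ y ∷ _) inc (x< , _) (_ , (xy , _) , (ny , _)) with open-compare (x< (here refl))
    ... | inj₁ lt = crossed⇒decreasing (inc (here refl)) (x< (here refl)) xy lt
    ... | inj₂ gt = nested⇒increasing (inc (there (here refl))) (x< (here refl)) ny gt
  doomed-absurd crossings d = go O id U.sorted d
    where
    go : ∀ {h n n′ r r′} {F : Flags (suc h)} (O′ : Vec ℕ _) → (∀ {i} → i ∈ᵥ O′ → i ∈ᵥ O) → Sorted O′ →
         ¬ Describes u (entry n (true ∷ r) (entry n′ (true ∷ r′) F)) O′
    go (x ∷ y ∷ z ∷ _) inc (x< , y< , _) (_ , (xy , _) , (_ , (yz , _) , _))
      with open-compare (x< (here refl)) | open-compare (y< (here refl))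
    ... | inj₁ lt | _ = crossed⇒decreasing (inc (here refl)) (x< (here refl)) xy lt
    ... | _ | inj₁ lt = crossed⇒decreasing (inc (there (here refl))) (y< (here refl)) yz lt
    ... | inj₂ gt | inj₂ gt′ =
      no-decreasing (inc (there (there (here refl)))) (x< (here refl)) (y< (here refl)) gt gt′
  doomed-absurd nestings d = go O id U.sorted d
    where
    go : ∀ {h n r r′ r″} {F : Flags h} (O′ : Vec ℕ _) → (∀ {i} → i ∈ᵥ O′ → i ∈ᵥ O) → Sorted O′ →
         ¬ Describes u (entry n r (entry true r′ (entry true r″ F))) O′
    go (x ∷ y ∷ z ∷ _) inc (x< , y< , _) (_ , _ , (ny , _ , (nz , _)))
      with open-compare (x< (here refl)) | open-compare (y< (here refl))
    ... | inj₂ gt | _ = nested⇒increasing (inc (there (here refl))) (x< (here refl)) ny gt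
    ... | _ | inj₂ gt = nested⇒increasing (inc (there (there (here refl)))) (y< (here refl)) nz gt
    ... | inj₁ lt | inj₁ lt′ =
      no-increasing (inc (here refl)) (inc (there (there (here refl)))) (x< (here refl)) (y< (here refl)) lt lt′

-- Erdős–Szekeres; transitivity of the two colours is not needed.
monochromatic-path : ∀ {R B : Fin 5 → Fin 5 → Set} →
  (∀ {i j} → i Fin.< j → R i j ⊎ B i j) →
  (∀ {i j k} → i Fin.< j → j Fin.< k → R i j → ¬ R j k) →
  (∀ {i j k} → i Fin.< j → j Fin.< k → B i j → ¬ B j k) → ⊥
monochromatic-path {R} {B} colour noR noB =
  [ first {R} {B} colour noR noB
           , first {B} {R} (swap ∘ colour) noB noR ] (colour {#0} {#2} (s≤s z≤n))
  where
  first : ∀ {R B : Fin 5 → Fin 5 → Set} →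
    (∀ {i j} → i Fin.< j → R i j ⊎ B i j) →
    (∀ {i j k} → i Fin.< j → j Fin.< k → R i j → ¬ R j k) →
    (∀ {i j k} → i Fin.< j → j Fin.< k → B i j → ¬ B j k) → ¬ R #0 #2
  first {R} {B} colour noR noB r02 = contra
    where
    1<2 : ∀ {n} → 1 < suc (suc n)
    1<2 = s≤s (s≤s z≤n)
    2<3 : ∀ {n} → 2 < suc (suc (suc n))
    2<3 = s≤s 1<2
    3<4 : 3 < 4
    3<4 = s≤s 2<3
    forceB : ∀ {i j} → i Fin.< j → ¬ R i j → B i j
    forceB i<j ¬r with colour i<j
    ... | inj₁ r = ⊥-elim (¬r r)
    ... | inj₂ b = b
    forceR : ∀ {i j} → i Fin.< j → ¬ B i j → R i j
    forceR i<j ¬b with colour i<j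
    ... | inj₁ r = r
    ... | inj₂ b = ⊥-elim (¬b b)
    -- The colour of 0-2 forces those of 2-3, 3-4, 1-2 and 0-1 in turn; then either colour of 1-3
    -- completes a path, with 3-4 or with 0-1.
    b23 : B #2 #3
    b23 = forceB 2<3 (noR (s≤s z≤n) 2<3 r02)
    r34 : R #3 #4
    r34 = forceR 3<4 (noB 2<3 3<4 b23)
    r12 : R #1 #2
    r12 = forceR 1<2 (λ b → noB 1<2 2<3 b b23)
    b01 : B #0 #1
    b01 = forceB (s≤s z≤n) (λ r → noR (s≤s z≤n) 1<2 r r12)
    contra : ⊥
    contra with colour {#1} {#3} 1<2
    ... | inj₁ r = noR 1<2 3<4 r r34
    ... | inj₂ b = noB (s≤s z≤n) 1<2 b01 b

-- Each pair of open slots is coloured by the order of its partners.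
five-open-absurd : ∀ {m t} {O : Vec ℕ 5} {u f} →
  Diagram m f → Prefix t O u → ¬ Extends t O u f
five-open-absurd {O = O} {f = f} D U E = monochromatic-path
  {λ i j → f (lookup O i) < f (lookup O j)} {λ i j → f (lookup O j) < f (lookup O i)}
  (open-compare D U E ∘ increasing)
  (λ {i} {j} {k} i<j j<k →
    no-increasing D U E (∈-lookup i O) (∈-lookup k O) (increasing i<j) (increasing j<k))
  (λ {i} {j} {k} i<j j<k → no-decreasing D U E (∈-lookup k O) (increasing i<j) (increasing j<k))
  where
  Sorted-lookup : ∀ {h} (O : Vec ℕ h) → Sorted O → ∀ {i j} → i Fin.< j → lookup O i < lookup O j
  Sorted-lookup (x ∷ O) (x< , s) {Fin.zero} {Fin.suc j} _ = x< (∈-lookup j O)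
  Sorted-lookup (x ∷ O) (x< , s) {Fin.suc i} {Fin.suc j} (s≤s i<j) = Sorted-lookup O s i<j
  increasing : ∀ {i j} → i Fin.< j → lookup O i < lookup O j
  increasing = Sorted-lookup O (Prefix.sorted U)

-- The effect of one more slot on a prefix

link : (ℕ → ℕ) → ℕ → ℕ → ℕ → ℕ
link u c t i with i ≟ c | i ≟ t
... | yes _ | _     = t
... | no _  | yes _ = c
... | no _  | no _  = u i

link-opener : ∀ u c t → link u c t c ≡ t
link-opener u c t with c ≟ c | c ≟ t
... | yes _ | _   = refl
... | no c≢ | _   = ⊥-elim (c≢ refl)

link-closer : ∀ u {c t} → c < t → link u c t t ≡ c
link-closer u {c} {t} c<t with t ≟ c | t ≟ t
... | yes refl | _    = ⊥-elim (<-irrefl refl c<t)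
... | no _ | yes _    = refl
... | no _ | no t≢    = ⊥-elim (t≢ refl)

link-other : ∀ u {c t i} → i ≢ c → i ≢ t → link u c t i ≡ u i
link-other u {c} {t} {i} i≢c i≢t with i ≟ c | i ≟ t
... | yes e | _    = ⊥-elim (i≢c e)
... | no _ | yes e = ⊥-elim (i≢t e)
... | no _ | no _  = refl

data Linked (u : ℕ → ℕ) (c t i : ℕ) : Set where
  at-opener : i ≡ c → link u c t i ≡ t → Linked u c t i
  at-closer : i ≡ t → link u c t i ≡ c → Linked u c t i
  elsewhere  : i ≢ c → i ≢ t → link u c t i ≡ u i → Linked u c t i

linked : ∀ u {c t} → c < t → ∀ i → Linked u c t i
linked u {c} {t} c<t i with i ≟ c | i ≟ t
... | yes refl | _    = at-opener refl (link-opener u c t)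
... | no _ | yes refl = at-closer refl (link-closer u c<t)
... | no i≢c | no i≢t = elsewhere i≢c i≢t (link-other u i≢c i≢t)

Uncrossed : ∀ {h} → (ℕ → ℕ) → Vec ℕ h → ℕ → Set
Uncrossed u O x = ∀ y → y ∈ᵥ O → x < y → ¬ Crossed u x y

Closable : ∀ {h} → (ℕ → ℕ) → Vec ℕ h → ℕ → Set
Closable u O c = Uncrossed u O c × (∀ x → x ∈ᵥ O → x < c → ¬ Nested u c)

Uncrossed-∷ : ∀ {h u x z} {O : Vec ℕ h} → z ≤ x → Uncrossed u O x → Uncrossed u (z ∷ O) x
Uncrossed-∷ z≤x q _ (here refl) x<z = ⊥-elim (<⇒≱ x<z z≤x)
Uncrossed-∷ z≤x q y (there y∈)  x<y = q y y∈ x<y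

Uncrossed-tail : ∀ {h u x z} {O : Vec ℕ h} → Uncrossed u (z ∷ O) x → Uncrossed u O x
Uncrossed-tail q y y∈ = q y (there y∈)

none-correct : ∀ {h u x} (r : Vec Bool h) (O : Vec ℕ h) → (∀ {y} → y ∈ᵥ O → x < y) →
               CrossedRow u x r O → Holds (none r) (Uncrossed u O x)
none-correct []      []      _  _         = λ _ ()
none-correct {u = u} {x} (b ∷ r) (y ∷ O) x< (hb , hr) =
  Holds-⇔ {Q = Uncrossed u (y ∷ O) x} (not b ∧ none r)
    (λ { (p , q) _ (here refl) _ → p ; (p , q) z (there z∈) → q z z∈ })
    (λ q → q y (here refl) (x< (here refl)) , Uncrossed-tail q)
    (Holds-∧ (not b) (none r) (Holds-not b hb) (none-correct r O (x< ∘ there) hr))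

closableAfter-correct : ∀ {h u} (F : Flags h) p (O : Vec ℕ h) → Sorted O → Describes u F O →
  Holds (closableAfter F p) (Uncrossed u O (lookup O p) × ¬ Nested u (lookup O p))
closableAfter-correct (entry n r F) Fin.zero (x ∷ O) (x< , s) (hn , hr , _) =
  Holds-⇔ (none r ∧ not n)
    (λ (p , q) → Uncrossed-∷ ≤-refl p , q)
    (λ (p , q) → Uncrossed-tail p , q)
    (Holds-∧ (none r) (not n) (none-correct r O x< hr) (Holds-not n hn))
closableAfter-correct (entry n r F) (Fin.suc p) (x ∷ O) (x< , s) (_ , _ , d) =
  Holds-⇔ (closableAfter F p)
    (λ (q , ¬n) → Uncrossed-∷ (<⇒≤ (x< (∈-lookup p O))) q , ¬n)
    (λ (q , ¬n) → Uncrossed-tail q , ¬n)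
    (closableAfter-correct F p O s d)

closable-correct : ∀ {h u} (F : Flags (suc h)) p (O : Vec ℕ (suc h)) → Sorted O → Describes u F O →
  Holds (closable F p) (Closable u O (lookup O p))
closable-correct (entry n r F) Fin.zero (x ∷ O) (x< , s) (hn , hr , _) =
  Holds-⇔ (none r)
    (λ p → Uncrossed-∷ ≤-refl p
         , (λ { _ (here refl) x<x → ⊥-elim (<-irrefl refl x<x)
              ; _ (there y∈) y<x → ⊥-elim (<-asym (x< y∈) y<x) }))
    (Uncrossed-tail ∘ proj₁)
    (none-correct r O x< hr)
closable-correct (entry n r F) (Fin.suc p) (x ∷ O) (x< , s) (_ , _ , d) =
  Holds-⇔ (closableAfter F p)
    (λ (q , ¬n) → Uncrossed-∷ (<⇒≤ (x< (∈-lookup p O))) q , λ _ _ _ → ¬n)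
    (λ (q , ¬n) → Uncrossed-tail q , ¬n x (here refl) (x< (∈-lookup p O)))
    (closableAfter-correct F p O s d)

module _ {t h} {O : Vec ℕ h} {u : ℕ → ℕ} (U : Prefix t O u) where
  open Prefix U

  fixed-prefix : Prefix (suc t) O u
  fixed-prefix = record
    { sorted = sorted ; below = m<n⇒m<1+n ∘ below ; involutive = involutive
    ; beyond = beyond ∘ <⇒≤ ; open-fixed = open-fixed
    ; noCrossing = noCrossing ; noNesting = noNesting }

  opened-prefix : Prefix (suc t) (O ∷ʳ t) u
  opened-prefix = record
    { sorted = Sorted-∷ʳ sorted below
    ; below = λ i∈ → [ m<n⇒m<1+n ∘ below , (λ { refl → ≤-refl }) ] (∈-∷ʳ⁻ O i∈)
    ; involutive = involutive
    ; beyond = beyond ∘ <⇒≤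
    ; open-fixed = λ i∈ → [ open-fixed , (λ { refl → beyond ≤-refl }) ] (∈-∷ʳ⁻ O i∈)
    ; noCrossing = crossing
    ; noNesting = nesting }
    where
    crossing : ∀ {a b c} → a < b → b < c → c < u a → u a < u b → c ∈ᵥ (O ∷ʳ t) ⊎ u b < u c → ⊥
    crossing a<b b<c c<ua ua<ub (inj₂ lt) = noCrossing a<b b<c c<ua ua<ub (inj₂ lt)
    crossing a<b b<c c<ua ua<ub (inj₁ c∈) with ∈-∷ʳ⁻ O c∈
    ... | inj₁ c∈O = noCrossing a<b b<c c<ua ua<ub (inj₁ c∈O)
    ... | inj₂ refl = <-asym c<ua (arc-end (<-trans a<b (<-trans b<c c<ua)))
    nesting : ∀ {a b c} → a < b → b < c → c < u c → u c < u b → a ∈ᵥ (O ∷ʳ t) ⊎ u b < u a → ⊥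
    nesting a<b b<c c<uc uc<ub (inj₂ lt) = noNesting a<b b<c c<uc uc<ub (inj₂ lt)
    nesting a<b b<c c<uc uc<ub (inj₁ a∈) with ∈-∷ʳ⁻ O a∈
    ... | inj₁ a∈O = noNesting a<b b<c c<uc uc<ub (inj₁ a∈O)
    ... | inj₂ refl = <-asym (arc-start c<uc) (<-trans a<b b<c)

  opened-describes : ∀ {F} → Describes u F O → Describes u (openLast F) (O ∷ʳ t)
  opened-describes {F} = go F O below
    where
    row : ∀ {h x} (r : Vec Bool h) (O : Vec ℕ h) → x < t → CrossedRow u x r O →
          CrossedRow u x (r ∷ʳ false) (O ∷ʳ t)
    row []      []      x<t _        = (λ (a , a<x , t<ua) → <-asym t<ua (bounded (<-trans a<x x<t))) , tt
    row (b ∷ r) (y ∷ O) x<t (hb , d) = hb , row r O x<t d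
    go : ∀ {h} (F : Flags h) (O : Vec ℕ h) → (∀ {i} → i ∈ᵥ O → i < t) →
         Describes u F O → Describes u (openLast F) (O ∷ʳ t)
    go []            []      below _ = (λ (a , t<a , a<ua) → <-asym t<a (arc-start a<ua)) , tt , tt
    go (entry n r F) (x ∷ O) below (hn , hr , d) =
      hn , row r O (below (here refl)) hr , go F O (below ∘ there) d

module _ {t h} {O : Vec ℕ (suc h)} {u : ℕ → ℕ} (U : Prefix t O u) (p : Fin (suc h)) where
  open Prefix U
  private
    c = lookup O p
    O′ = removeAt O p
    u′ = link u c t
    c∈O : c ∈ᵥ O
    c∈O = ∈-lookup p O
    c<t : c < t
    c<t = below c∈O
    view = linked u c<t
    O′⊆O : ∀ {i} → i ∈ᵥ O′ → i ∈ᵥ O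
    O′⊆O = ∈-removeAt⁻ O p
    O′≢c : ∀ {i} → i ∈ᵥ O′ → i ≢ c
    O′≢c = ∈-removeAt-≢ O p sorted
    O′≢t : ∀ {i} → i ∈ᵥ O′ → i ≢ t
    O′≢t i∈ e = <-irrefl e (below (O′⊆O i∈))

    link-bounded : ∀ {i} → i ≤ t → u′ i ≤ t
    link-bounded {i} i≤t with view i
    ... | at-opener _ e       = ≤-reflexive e
    ... | at-closer _ e       = ≤-trans (≤-reflexive e) (<⇒≤ c<t)
    ... | elsewhere _ i≢t e    = ≤-trans (≤-reflexive e) (<⇒≤ (bounded (≤∧≢⇒< i≤t i≢t)))

    link-beyond : ∀ {i} → suc t ≤ i → u′ i ≡ i
    link-beyond {i} t<i with view i
    ... | at-opener refl _ = ⊥-elim (<-asym t<i c<t)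
    ... | at-closer refl _ = ⊥-elim (<-irrefl refl t<i)
    ... | elsewhere _ _ e   = trans e (beyond (<⇒≤ t<i))

    link-start : ∀ {a b} → a < b → b < u′ a → a ≤ t × u′ a ≤ t
    link-start {a} a<b b<ua with a ℕ.≤? t
    ... | yes a≤t = a≤t , link-bounded a≤t
    ... | no a≰t = ⊥-elim (<-asym a<b (subst (_ <_) (link-beyond (≰⇒> a≰t)) b<ua))

    link-involutive : ∀ i → u′ (u′ i) ≡ i
    link-involutive i with view i
    ... | at-opener refl e = trans (cong u′ e) (link-closer u c<t)
    ... | at-closer refl e = trans (cong u′ e) (link-opener u c t)
    ... | elsewhere i≢c i≢t e = trans (cong u′ e) (trans (link-other u ui≢c ui≢t) (involutive i))
      where
      ui≢c : u i ≢ c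
      ui≢c e = i≢c (trans (sym (involutive i)) (trans (cong u e) (open-fixed c∈O)))
      ui≢t : u i ≢ t
      ui≢t e = i≢t (trans (sym (involutive i)) (trans (cong u e) (beyond ≤-refl)))

  closed-extends : ∀ {f} → (∀ i → f (f i) ≡ i) → Extends t O u f → f t ≡ c → Extends (suc t) O′ u′ f
  closed-extends {f} inv E ft≡c = record { agrees = agr ; later = lat }
    where
    open Extends E
    agr : ∀ {i} → i < suc t → ¬ i ∈ᵥ O′ → f i ≡ u′ i
    agr {i} i<1+t i∉O′ with view i
    ... | at-opener refl e = trans (trans (cong f (sym ft≡c)) (inv t)) (sym e)
    ... | at-closer refl e = trans ft≡c (sym e)
    ... | elsewhere i≢c i≢t e = trans
      (agrees (≤∧≢⇒< (≤-pred i<1+t) i≢t) (λ i∈O → i∉O′ (∈-removeAt⁺ O p i∈O i≢c))) (sym e)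
    lat : ∀ {i} → i ∈ᵥ O′ → suc t ≤ f i
    lat {i} i∈ = ≤∧≢⇒< (later (O′⊆O i∈))
      (λ t≡fi → O′≢c i∈ (trans (sym (inv i)) (trans (cong f (sym t≡fi)) ft≡c)))

  closed-extends⁻ : ∀ {f} → Extends (suc t) O′ u′ f → Extends t O u f × f t ≡ c
  closed-extends⁻ {f} E = record { agrees = agr ; later = lat } , ft≡c
    where
    open Extends E
    ft≡c : f t ≡ c
    ft≡c = trans (agrees ≤-refl (λ t∈ → O′≢t t∈ refl)) (link-closer u c<t)
    agr : ∀ {i} → i < t → ¬ i ∈ᵥ O → f i ≡ u i
    agr {i} i<t i∉O = trans (agrees (m<n⇒m<1+n i<t) (i∉O ∘ O′⊆O))
      (link-other u (λ { refl → i∉O c∈O }) (<⇒≢ i<t))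
    lat : ∀ {i} → i ∈ᵥ O → t ≤ f i
    lat {i} i∈ with i ≟ c
    ... | no i≢c = <⇒≤ (later (∈-removeAt⁺ O p i∈ i≢c))
    ... | yes refl = ≤-reflexive (sym (trans (agrees (m<n⇒m<1+n c<t) (λ c∈ → O′≢c c∈ refl))
                                             (link-opener u c t)))

  -- An arc from `c` that ends at `t` ends before all other open arcs. A common crossing with a
  -- later open slot, or a nesting below an earlier one, would force the opposite order.
  extends⇒closable : ∀ {m f} → Diagram m f → Extends t O u f → f t ≡ c → Closable u O c
  extends⇒closable {m} {f} D E ft≡c =
    (λ _ y∈O c<y cr → crossed⇒decreasing D U E c∈O c<y cr (after y∈O (<⇒≢ c<y ∘ sym))) ,
    (λ _ x∈O x<c ne → nested⇒increasing D U E c∈O x<c ne (after x∈O (<⇒≢ x<c)))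
    where
    open Diagram D using () renaming (involutive to inv; injective to inj)
    open Extends E
    fc≡t : f c ≡ t
    fc≡t = trans (cong f (sym ft≡c)) (inv t)
    after : ∀ {y} → y ∈ᵥ O → y ≢ c → f c < f y
    after {y} y∈O y≢c = ≤∧≢⇒< (≤-trans (≤-reflexive fc≡t) (later y∈O)) (y≢c ∘ sym ∘ inj)

  -- A new forbidden triple must contain the arc from `c` to `t`. As `t` is the last slot so far,
  -- this arc cannot be the first of three crossing arcs or the innermost of three nested ones. As
  -- the middle arc it is excluded by closability. As the last of a crossing or the outermost of a
  -- nesting it was already excluded when it was open, since open arcs counted there as ending last.
  closed-prefix : Closable u O c → Prefix (suc t) O′ u′
  closed-prefix (¬crossed , ¬nested) = record
    { sorted = Sorted-removeAt O p sorted
    ; below = m<n⇒m<1+n ∘ below ∘ O′⊆O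
    ; involutive = link-involutive
    ; beyond = link-beyond
    ; open-fixed = λ i∈ → trans (link-other u (O′≢c i∈) (O′≢t i∈)) (open-fixed (O′⊆O i∈))
    ; noCrossing = crossing
    ; noNesting = nesting }
    where
    crossing : ∀ {x y z} → x < y → y < z → z < u′ x → u′ x < u′ y → z ∈ᵥ O′ ⊎ u′ y < u′ z → ⊥
    crossing {x} {y} {z} x<y y<z z<ux ux<uy alt
      with link-start (<-trans x<y y<z) z<ux
    ... | x≤t , ux≤t with <-≤-trans z<ux ux≤t
    ... | z<t with view x | view y
    ... | _ | at-closer refl _ = <-asym y<z z<t
    ... | at-closer refl _ | _ = <-asym (<-trans x<y y<z) z<t
    ... | at-opener refl ex | _ = <⇒≱ (subst (_< u′ y) ex ux<uy) (link-bounded (<⇒≤ (<-trans y<z z<t)))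
    ... | elsewhere x≢c x≢t ex | at-opener refl ey with alt
    ...   | inj₁ z∈ = ¬crossed z (O′⊆O z∈) y<z (x , x<y , subst (z <_) ex z<ux)
    ...   | inj₂ lt = <⇒≱ (subst (_< u′ z) ey lt) (link-bounded (<⇒≤ z<t))
    crossing {x} {y} {z} x<y y<z z<ux ux<uy alt | x≤t , ux≤t | z<t
        | elsewhere x≢c x≢t ex | elsewhere y≢c y≢t ey
      with alt | view z
    ... | inj₁ z∈ | _ = old (inj₁ (O′⊆O z∈))
      where
      old : z ∈ᵥ O ⊎ u y < u z → ⊥
      old = noCrossing x<y y<z (subst (z <_) ex z<ux) (subst (_< u y) ex (subst (u′ x <_) ey ux<uy))
    ... | inj₂ _ | at-opener refl _ =
      noCrossing x<y y<z (subst (z <_) ex z<ux) (subst (_< u y) ex (subst (u′ x <_) ey ux<uy)) (inj₁ c∈O)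
    ... | inj₂ _ | at-closer refl _ = <-irrefl refl z<t
    ... | inj₂ lt | elsewhere _ _ ez =
      noCrossing x<y y<z (subst (z <_) ex z<ux) (subst (_< u y) ex (subst (u′ x <_) ey ux<uy))
        (inj₂ (subst (_< u z) ey (subst (u′ y <_) ez lt)))
    nesting : ∀ {x y z} → x < y → y < z → z < u′ z → u′ z < u′ y → x ∈ᵥ O′ ⊎ u′ y < u′ x → ⊥
    nesting {x} {y} {z} x<y y<z z<uz uz<uy alt with link-start y<z (<-trans z<uz uz<uy)
    ... | y≤t , uy≤t with <-≤-trans (<-trans z<uz uz<uy) uy≤t
    ... | z<t with view z | view y
    ... | at-closer refl _ | _ = <-irrefl refl z<t
    ... | at-opener refl ez | _ = <⇒≱ (subst (_< u′ y) ez uz<uy) uy≤t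
    ... | _ | at-closer refl _ = <-asym y<z z<t
    ... | elsewhere z≢c z≢t ez | at-opener refl ey with alt
    ...   | inj₁ x∈ = ¬nested x (O′⊆O x∈) x<y (z , y<z , subst (z <_) ez z<uz)
    ...   | inj₂ lt = <⇒≱ (subst (_< u′ x) ey lt) (link-bounded (<⇒≤ (<-trans x<y (<-trans y<z z<t))))
    nesting {x} {y} {z} x<y y<z z<uz uz<uy alt | y≤t , uy≤t | z<t
        | elsewhere z≢c z≢t ez | elsewhere y≢c y≢t ey = split alt (view x)
      where
      old : x ∈ᵥ O ⊎ u y < u x → ⊥
      old = noNesting x<y y<z (subst (z <_) ez z<uz) (subst (_< u y) ez (subst (u′ z <_) ey uz<uy))
      split : x ∈ᵥ O′ ⊎ u′ y < u′ x → Linked u c t x → ⊥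
      split (inj₁ x∈) _               = old (inj₁ (O′⊆O x∈))
      split (inj₂ _) (at-opener refl _)  = old (inj₁ c∈O)
      split (inj₂ _) (at-closer refl _)  = <-asym (<-trans x<y y<z) z<t
      split (inj₂ lt) (elsewhere _ _ ex)  = old (inj₂ (subst (_< u x) ey (subst (u′ y <_) ex lt)))

  closed-describes : ∀ {F} → Describes u F O → Describes u′ (close F p) O′
  closed-describes {F} = go F O p refl below sorted
    where
    crossed-before : ∀ {x y} → x < c → x < y → Crossed u x y → Crossed u′ x y
    crossed-before x<c x<y (a , a<x , y<ua) =
      a , a<x , subst (_ <_) (sym (link-other u (<⇒≢ (<-trans a<x x<c))
                                                (<⇒≢ (<-trans a<x (<-trans x<c c<t))))) y<ua
    crossed-before⁻ : ∀ {x y} → x < c → Crossed u′ x y → Crossed u x y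
    crossed-before⁻ x<c (a , a<x , y<ua) =
      a , a<x , subst (_ <_) (link-other u (<⇒≢ (<-trans a<x x<c))
                                           (<⇒≢ (<-trans a<x (<-trans x<c c<t)))) y<ua
    nested-after : ∀ {x} → Nested u x → Nested u′ x
    nested-after (a , x<a , a<ua) = a , x<a , subst (a <_) (sym (link-other u
      (λ { refl → arc-closed a<ua c∈O }) (<⇒≢ (arc-start a<ua)))) a<ua
    nested-after⁻ : ∀ {x} → c < x → Nested u′ x → Nested u x
    nested-after⁻ c<x (a , x<a , a<ua) with view a
    ... | at-opener refl _ = ⊥-elim (<-asym c<x x<a)
    ... | at-closer refl e = ⊥-elim (<-asym c<t (subst (t <_) e a<ua))
    ... | elsewhere _ _ e   = a , x<a , subst (a <_) e a<ua
    all-row : ∀ {h x} → c < x → (O : Vec ℕ h) → (∀ {i} → i ∈ᵥ O → i < t) →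
              CrossedRow u′ x (replicate h true) O
    all-row c<x []      _     = tt
    all-row c<x (y ∷ O) below =
      (c , c<x , subst (y <_) (sym (link-opener u c t)) (below (here refl))) , all-row c<x O (below ∘ there)
    after : ∀ {h} (F : Flags h) (O : Vec ℕ h) → (∀ {i} → i ∈ᵥ O → i < t) → (∀ {i} → i ∈ᵥ O → c < i) →
            Describes u F O → Describes u′ (allCrossed F) O
    after []            []      _     _   _ = tt
    after (entry n r F) (x ∷ O) below c< (hn , _ , d) =
      Holds-⇔ n nested-after (nested-after⁻ (c< (here refl))) hn ,
      all-row (c< (here refl)) O (below ∘ there) , after F O (below ∘ there) (c< ∘ there) d
    row : ∀ {h x} → x < c → (r : Vec Bool h) (O : Vec ℕ h) → (∀ {y} → y ∈ᵥ O → x < y) →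
          CrossedRow u x r O → CrossedRow u′ x r O
    row x<c []      []      x< _         = tt
    row x<c (b ∷ r) (y ∷ O) x< (hb , hr) =
      Holds-⇔ b (crossed-before x<c (x< (here refl))) (crossed-before⁻ x<c) hb , row x<c r O (x< ∘ there) hr
    remove-row : ∀ {h x} (r : Vec Bool (suc h)) (O : Vec ℕ (suc h)) q →
                 CrossedRow u′ x r O → CrossedRow u′ x (removeAt r q) (removeAt O q)
    remove-row (b ∷ r)         (y ∷ O)         Fin.zero    (_ , hr)  = hr
    remove-row (b ∷ r@(_ ∷ _)) (y ∷ O@(_ ∷ _)) (Fin.suc q) (hb , hr) = hb , remove-row r O q hr
    go : ∀ {h} (F : Flags (suc h)) (O : Vec ℕ (suc h)) q → lookup O q ≡ c →
         (∀ {i} → i ∈ᵥ O → i < t) → Sorted O → Describes u F O →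
         Describes u′ (close F q) (removeAt O q)
    go (entry n r F) (x ∷ O) Fin.zero refl below (x< , _) (_ , _ , d) = after F O (below ∘ there) x< d
    go (entry n r F@(entry _ _ _)) (x ∷ O@(_ ∷ _)) (Fin.suc q) e below (x< , s) (_ , hr , d) =
      (c , x<c , subst (c <_) (sym (link-opener u c t)) c<t) ,
      remove-row r O q (row x<c r O x< hr) , go F O q e (below ∘ there) s d
      where
      x<c : x < c
      x<c = subst (x <_) e (x< (∈-lookup q O))

module _ {t h} {O : Vec ℕ h} {u f : ℕ → ℕ} (U : Prefix t O u) (inv : ∀ i → f (f i) ≡ i) where
  open Prefix U
  private
    avoids-t : ∀ {i} → i ∈ᵥ O → t ≤ f t → f i ≢ t
    avoids-t {i} i∈ t≤ft e = <⇒≱ (below i∈) (subst (t ≤_) (trans (cong f (sym e)) (inv i)) t≤ft)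

  fixed-extends : Extends t O u f → f t ≡ t → Extends (suc t) O u f
  fixed-extends E ft≡t = record { agrees = agr ; later = lat }
    where
    open Extends E
    agr : ∀ {i} → i < suc t → ¬ i ∈ᵥ O → f i ≡ u i
    agr {i} i<1+t i∉ with i ≟ t
    ... | yes refl = trans ft≡t (sym (beyond ≤-refl))
    ... | no i≢t   = agrees (≤∧≢⇒< (≤-pred i<1+t) i≢t) i∉
    lat : ∀ {i} → i ∈ᵥ O → suc t ≤ f i
    lat i∈ = ≤∧≢⇒< (later i∈) (avoids-t i∈ (≤-reflexive (sym ft≡t)) ∘ sym)

  opened-extends : Extends t O u f → t < f t → Extends (suc t) (O ∷ʳ t) u f
  opened-extends E t<ft = record { agrees = agr ; later = lat }
    where
    open Extends E
    agr : ∀ {i} → i < suc t → ¬ i ∈ᵥ (O ∷ʳ t) → f i ≡ u i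
    agr {i} i<1+t i∉ = agrees (≤∧≢⇒< (≤-pred i<1+t) (λ { refl → i∉ (last-∈ O) })) (i∉ ∘ ∈-∷ʳ⁺ O)
    lat : ∀ {i} → i ∈ᵥ (O ∷ʳ t) → suc t ≤ f i
    lat i∈ with ∈-∷ʳ⁻ O i∈
    ... | inj₁ i∈O = ≤∧≢⇒< (later i∈O) (avoids-t i∈O (<⇒≤ t<ft) ∘ sym)
    ... | inj₂ refl = t<ft

  -- If `f t` were not open, `u` would already match it with `t`, yet completed arcs end before `t`.
  closer-open : Extends t O u f → f t < t → f t ∈ᵥ O
  closer-open E ft<t with f t ∈ᵥ? O
  ... | yes ft∈ = ft∈
  ... | no ft∉ = ⊥-elim (<-irrefl (sym (trans (sym (inv t)) (Extends.agrees E ft<t ft∉))) (bounded ft<t))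

module _ {t h} {O : Vec ℕ h} {u f : ℕ → ℕ} (U : Prefix t O u) where
  open Prefix U

  fixed-extends⁻ : Extends (suc t) O u f → Extends t O u f × f t ≡ t
  fixed-extends⁻ E =
    record { agrees = agrees ∘ m<n⇒m<1+n ; later = <⇒≤ ∘ later } ,
    trans (agrees ≤-refl (<-irrefl refl ∘ below)) (beyond ≤-refl)
    where open Extends E

  opened-extends⁻ : Extends (suc t) (O ∷ʳ t) u f → Extends t O u f × t < f t
  opened-extends⁻ E =
    record { agrees = λ i<t i∉ → agrees (m<n⇒m<1+n i<t)
               (λ i∈ → [ i∉ , (λ { refl → <-irrefl refl i<t }) ] (∈-∷ʳ⁻ O i∈))
           ; later = λ i∈ → <⇒≤ (later (∈-∷ʳ⁺ O i∈)) } ,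
    later (last-∈ O)
    where open Extends E

-- Enumeration of the diagrams that conform to given policies

-- The objects a ∈ P encode, via ⟦_⟧, exactly the diagrams without triple crossings and nestings
-- whose slots have the types permitted by Π.
module Enumeration {A : Set} (P : A → Set) (⟦_⟧ : A → ℕ → ℕ) {m : ℕ} (Π : Vec Policy m)
  (diagram    : ∀ {a} → P a → Diagram m ⟦ a ⟧)
  (conforms   : ∀ {a} → P a → Conforms 0 Π ⟦ a ⟧)
  (injective  : ∀ {a b} → P a → P b → (∀ i → ⟦ a ⟧ i ≡ ⟦ b ⟧ i) → a ≡ b)
  (surjective : ∀ {f} → Diagram m f → Conforms 0 Π f → ∃ λ a → P a × (∀ i → ⟦ a ⟧ i ≡ f i))
  where

  Continues : ∀ {h} → ℕ → Vec ℕ h → (ℕ → ℕ) → A → Set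
  Continues t O u a = P a × Extends t O u ⟦ a ⟧

  -- At the end `u` itself is the only extension of the prefix; a slot that is still open has
  -- nowhere left to end.
  leaf : ∀ {h t} (k : Kind h) (O : Vec ℕ h) u → t ≡ m → Prefix t O u →
         (∀ f → Extends t O u f → Conforms 0 Π f) →
         Continues t O u HasSize (weight k * completions [] h)
  leaf k0 [] u refl U conf =
    let a , pa , a≡u = surjective D (conf u (record { agrees = λ _ _ → refl ; later = λ () }))
    in size-singleton a
         (pa , record { agrees = λ {i} _ _ → a≡u i ; later = λ () })
         (λ (pb , E) → injective pb pa (λ i → trans (same pb E i) (sym (a≡u i))))
    where
    open Prefix U
    D : Diagram m u
    D = record
      { involutive = involutive ; outside = beyond
      ; noCrossing = λ a<b b<c p q r → noCrossing a<b b<c p q (inj₂ r)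
      ; noNesting  = λ a<b b<c p q r → noNesting a<b b<c p q (inj₂ r) }
    same : ∀ {b} → P b → Extends m [] u ⟦ b ⟧ → ∀ i → ⟦ b ⟧ i ≡ u i
    same pb E i with i <? m
    ... | yes i<m = Extends.agrees E i<m λ ()
    ... | no i≮m = trans (Diagram.outside (diagram pb) (≮⇒≥ i≮m)) (sym (beyond (≮⇒≥ i≮m)))
  leaf {suc h} k (x ∷ O) u refl U conf = subst (Continues m (x ∷ O) u HasSize_) (sym (*-zeroʳ (weight k)))
    (size-empty (λ (pa , E) → <⇒≱ (Diagram.bounded (diagram pa) (Prefix.below U (here refl)))
                                  (Extends.later E (here refl))))

  module Step {h t r} (π : Policy) {πs : Vec Policy r} (O : Vec ℕ h) (u : ℕ → ℕ) (U : Prefix t O u)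
    (suffix : ∀ f → Conforms 0 Π f → Conforms t (π ∷ πs) f) where

    Fixed Opened Closed : A → Set
    Fixed a  = Continues t O u a × ⟦ a ⟧ t ≡ t
    Opened a = Continues t O u a × t < ⟦ a ⟧ t
    Closed a = ∃ λ p → Continues t O u a × ⟦ a ⟧ t ≡ lookup O p

    split : ∀ {n₁ n₂ n₃} → (T (fixed π) → Fixed HasSize n₁) → (T (opener π) → Opened HasSize n₂) →
            (T (closer π) → Closed HasSize n₃) →
            Continues t O u HasSize ((if fixed π then n₁ else 0)
              + ((if opener π then n₂ else 0) + (if closer π then n₃ else 0)))
    split s₁ s₂ s₃ = size-⇔
      (λ { (inj₁ (_ , c , _)) → c ; (inj₂ (inj₁ (_ , c , _))) → c ; (inj₂ (inj₂ (_ , _ , c , _))) → c })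
      classify
      (size-⊎ (λ { (_ , _ , e) (inj₁ (_ , _ , lt)) → <-irrefl (sym e) lt
                 ; (_ , _ , e) (inj₂ (_ , p , _ , e′)) →
                     <-irrefl (trans (sym e′) e) (Prefix.below U (∈-lookup p O)) })
        (size-if (fixed π) s₁)
        (size-⊎ (λ { (_ , _ , lt) (_ , p , _ , e) →
                       <-asym lt (subst (_< t) (sym e) (Prefix.below U (∈-lookup p O))) })
          (size-if (opener π) s₂) (size-if (closer π) s₃)))
      where
      classify : ∀ {a} → Continues t O u a →
        T (fixed π) × Fixed a ⊎ (T (opener π) × Opened a ⊎ T (closer π) × Closed a)
      classify {a} c@(pa , E) with suffix ⟦ a ⟧ (conforms pa)
      ... | (if< , if≡ , if>) , _ with <-cmp (⟦ a ⟧ t) t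
      ... | tri≈ _ e _ = inj₁ (if≡ e , c , e)
      ... | tri> _ _ gt = inj₂ (inj₁ (if> gt , c , gt))
      ... | tri< lt _ _ = inj₂ (inj₂ (if< lt , index ft∈ , c , lookup-index ft∈))
        where
        ft∈ : ⟦ a ⟧ t ∈ᵥ O
        ft∈ = closer-open U (Diagram.involutive (diagram pa)) E lt

  weighted-if : ∀ w b n → (if b then w * n else 0) ≡ w * (if b then n else 0)
  weighted-if w true  n = refl
  weighted-if w false n = sym (*-zeroʳ w)

  -- The types of the slots already read are kept only through two implications: `suffix` restricts
  -- conformity to the remaining slots, and `whole` recovers it for every extension of the prefix.
  -- The latter is what allows `surjective` to be applied at the leaf.
  count : ∀ {h t r} (πs : Vec Policy r) (k : Kind h) (O : Vec ℕ h) u → t + r ≡ m → Prefix t O u →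
          Describes u (flags k) O →
          (∀ f → Conforms 0 Π f → Conforms t πs f) →
          (∀ f → Extends t O u f → Conforms t πs f → Conforms 0 Π f) →
          Continues t O u HasSize (weight k * completions πs h)
  count {t = t} [] k O u t+0≡m U d suffix whole =
    leaf k O u (trans (sym (+-identityʳ t)) t+0≡m) U (λ f E → whole f E tt)
  count {h} {t} {suc r} (π ∷ πs) k O u t+r≡m U d suffix whole =
    subst (Continues t O u HasSize_) total
      (split (λ ok → size-⇔ (λ (pa , E) → let E′ , e = fixed-extends⁻ U E in (pa , E′) , e)
                            (λ ((pa , E) , e) → pa , fixed-extends U (inv pa) E e)
                            (fixed-count ok))
             (opened-count (opening k))
             closed-count)
    where
    open Step π O u U suffix
    inv : ∀ {a} → P a → ∀ i → ⟦ a ⟧ (⟦ a ⟧ i) ≡ i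
    inv pa = Diagram.involutive (diagram pa)
    w = weight k
    g = completions πs
    1+t+r≡m : suc t + r ≡ m
    1+t+r≡m = trans (sym (+-suc t r)) t+r≡m
    suffix′ : ∀ f → Conforms 0 Π f → Conforms (suc t) πs f
    suffix′ f = proj₂ ∘ suffix f
    fixed-count : T (fixed π) → Continues (suc t) O u HasSize (w * g h)
    fixed-count ok = count πs k O u 1+t+r≡m (fixed-prefix U) d suffix′
      (λ f E conf → let E′ , e = fixed-extends⁻ U E in
        whole f E′ (((λ lt → ⊥-elim (<-irrefl e lt)) , (λ _ → ok) , (λ gt → ⊥-elim (<-irrefl (sym e) gt)))
                   , conf))
    opened-count : _ → T (opener π) → Opened HasSize (w * upward g h)
    opened-count (inj₁ (k′ , flags≡ , w≡)) ok = subst (Opened HasSize_) (w≡ g)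
      (size-⇔ (λ (pa , E) → let E′ , e = opened-extends⁻ U E in (pa , E′) , e)
              (λ ((pa , E) , e) → pa , opened-extends U (inv pa) E e)
              (count πs k′ (O ∷ʳ t) u 1+t+r≡m (opened-prefix U)
                (subst (λ F → Describes u F (O ∷ʳ t)) flags≡ (opened-describes U d)) suffix′
                (λ f E conf → let E′ , gt = opened-extends⁻ U E in
                  whole f E′ (((λ lt → ⊥-elim (<-asym gt lt)) , (λ e → ⊥-elim (<-irrefl (sym e) gt)) , λ _ → ok)
                             , conf))))
    opened-count (inj₂ refl) ok = subst (Opened HasSize_) (sym (*-zeroʳ w))
      (size-empty (λ ((pa , E) , gt) →
        five-open-absurd (diagram pa) (opened-prefix U) (opened-extends U (inv pa) E gt)))
    closed-count : T (closer π) → Closed HasSize (w * downward g h)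
    closed-count ok = go h refl
      where
      go : ∀ h′ → h ≡ h′ → Closed HasSize (w * downward g h)
      go zero refl = subst (Closed HasSize_) (sym (*-zeroʳ w)) (size-empty λ ())
      go (suc h′) refl = subst (Closed HasSize_) (closing-weight k g)
        (size-∃Fin
          (λ ((pa , _) , e) (_ , e′) → Sorted-lookup-injective O (Prefix.sorted U) (trans (sym e) e′))
          (λ p → by-move p (move k p)))
        where
        by-move : ∀ p (mv : Move (flags k) p) →
                  (λ a → Continues t O u a × ⟦ a ⟧ t ≡ lookup O p) HasSize (moveWeight mv * g h′)
        by-move p mv with closable-correct (flags k) p O (Prefix.sorted U) d
        by-move p (blocked e) | c rewrite e =
          size-empty (λ ((pa , E) , e) → c (extends⇒closable U p (diagram pa) E e))
        -- Legality of the closing comes from the assumed diagram itself, which then contradicts the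
        -- flags after the closing.
        by-move p (doomed bad) | _ = size-empty (λ ((pa , E) , e) →
          doomed-absurd (diagram pa) (closed-prefix U p (extends⇒closable U p (diagram pa) E e))
            (closed-extends U p (inv pa) E e) bad (closed-describes U p d))
        by-move p (to k′ e flags≡) | c rewrite e =
          size-⇔ (λ (pa , E) → let E′ , e = closed-extends⁻ U p E in (pa , E′) , e)
                 (λ ((pa , E) , e) → pa , closed-extends U p (inv pa) E e)
            (count πs k′ (removeAt O p) (link u (lookup O p) t) 1+t+r≡m (closed-prefix U p c)
              (subst (λ F → Describes _ F (removeAt O p)) flags≡ (closed-describes U p d)) suffix′
              (λ f E conf → let E′ , e = closed-extends⁻ U p E
                                lt = subst (_< t) (sym e) (Prefix.below U (∈-lookup p O)) in
                whole f E′ (((λ _ → ok) , (λ e → ⊥-elim (<-irrefl e lt)) , (λ gt → ⊥-elim (<-asym lt gt)))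
                           , conf)))
    total : (if fixed π then w * g h else 0)
            + ((if opener π then w * upward g h else 0) + (if closer π then w * downward g h else 0))
            ≡ w * completions (π ∷ πs) h
    total = sym (trans (*-distribˡ-+ w (if fixed π then g h else 0) _) (cong₂ _+_
      (sym (weighted-if w (fixed π) (g h)))
      (trans (*-distribˡ-+ w (if opener π then upward g h else 0) _) (cong₂ _+_
        (sym (weighted-if w (opener π) (upward g h)))
        (sym (weighted-if w (closer π) (downward g h)))))))

  enumerated : P HasSize completions Π 0
  enumerated = subst (P HasSize_) (+-identityʳ _)
    (size-⇔ proj₁ (λ pa → pa , record { agrees = λ () ; later = λ () })
      (count Π k0 [] id refl
        (record { sorted = tt ; below = λ () ; involutive = λ _ → refl ; beyond = λ _ → refl
                ; open-fixed = λ ()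
                ; noCrossing = λ a<b b<c c<a → ⊥-elim (<-asym c<a (<-trans a<b b<c))
                ; noNesting = λ _ _ c<c → ⊥-elim (<-irrefl refl c<c) })
        tt (λ _ → id) (λ _ _ → id)))

-- Pattern avoidance, and matchings as diagrams

Chain : ∀ {m j} → Vec (Fin m) j → Set
Chain []          = ⊤
Chain (_ ∷ [])    = ⊤
Chain (x ∷ y ∷ s) = x Fin.< y × Chain (y ∷ s)

Chain⇒Increasing : ∀ {m j} (s : Vec (Fin m) j) → Chain s → Increasing s
Chain⇒Increasing (x ∷ s) c Fin.zero (Fin.suc b) _ = head-< s c b
  where
  head-< : ∀ {m j} {x : Fin m} (s : Vec (Fin m) j) → Chain (x ∷ s) → ∀ b → x Fin.< lookup s b
  head-< (y ∷ s) (x<y , _) Fin.zero    = x<y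
  head-< (y ∷ s) (x<y , c) (Fin.suc b) = <-trans x<y (head-< s c b)
Chain⇒Increasing (x ∷ y ∷ s) (_ , c) (Fin.suc a) (Fin.suc b) (s≤s a<b) =
  Chain⇒Increasing (y ∷ s) c a b a<b

module _ {m} (Arc : Fin m → Fin m → Set) where

  -- Because of `opposite`, the pattern 321 joins the positions 0-3, 1-4, 2-5, a triple crossing,
  -- while 123 joins 0-5, 1-4, 2-3, a triple nesting.
  avoids-321⁻ : Avoids Arc p321 → ∀ {a b c d e f} → a Fin.< b → b Fin.< c → c Fin.< d → d Fin.< e → e Fin.< f →
                Arc a d → Arc b e → Arc c f → ⊥
  avoids-321⁻ av {a} {b} {c} {d} {e} {f} ab bc cd de ef ad be cf = av s
    (Chain⇒Increasing s (ab , bc , cd , de , ef , tt) , λ { #0 → ad ; #1 → be ; #2 → cf })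
    where s = a ∷ b ∷ c ∷ d ∷ e ∷ f ∷ []

  avoids-123⁻ : Avoids Arc p123 → ∀ {a b c d e f} → a Fin.< b → b Fin.< c → c Fin.< d → d Fin.< e → e Fin.< f →
                Arc a f → Arc b e → Arc c d → ⊥
  avoids-123⁻ av {a} {b} {c} {d} {e} {f} ab bc cd de ef af be cd′ = av s
    (Chain⇒Increasing s (ab , bc , cd , de , ef , tt) , λ { #0 → af ; #1 → be ; #2 → cd′ })
    where s = a ∷ b ∷ c ∷ d ∷ e ∷ f ∷ []

  avoids-321⁺ : (∀ {a b c d e f} → a Fin.< b → b Fin.< c → c Fin.< d → d Fin.< e → e Fin.< f →
                 Arc a d → Arc b e → Arc c f → ⊥) → Avoids Arc p321
  avoids-321⁺ absent (a ∷ b ∷ c ∷ d ∷ e ∷ f ∷ []) (inc , arcs) =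
    absent (inc #0 #1 z<s) (inc #1 #2 (s≤s z<s)) (inc #2 #3 (s≤s (s≤s z<s))) (inc #3 #4 (s≤s (s≤s (s≤s z<s))))
       (inc #4 #5 (s≤s (s≤s (s≤s (s≤s z<s))))) (arcs #0) (arcs #1) (arcs #2)

  avoids-123⁺ : (∀ {a b c d e f} → a Fin.< b → b Fin.< c → c Fin.< d → d Fin.< e → e Fin.< f →
                 Arc a f → Arc b e → Arc c d → ⊥) → Avoids Arc p123
  avoids-123⁺ absent (a ∷ b ∷ c ∷ d ∷ e ∷ f ∷ []) (inc , arcs) =
    absent (inc #0 #1 z<s) (inc #1 #2 (s≤s z<s)) (inc #2 #3 (s≤s (s≤s z<s))) (inc #3 #4 (s≤s (s≤s (s≤s z<s))))
       (inc #4 #5 (s≤s (s≤s (s≤s (s≤s z<s))))) (arcs #0) (arcs #1) (arcs #2)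

conforms⁻ : ∀ {r f t} (πs : Vec Policy r) → Conforms t πs f →
            ∀ i → Permits (lookup πs i) (t + toℕ i) (f (t + toℕ i))
conforms⁻ {f = f} {t} (π ∷ πs) (p , c) Fin.zero    =
  subst (λ s → Permits π s (f s)) (sym (+-identityʳ t)) p
conforms⁻ {f = f} {t} (π ∷ πs) (p , c) (Fin.suc i) =
  subst (λ s → Permits (lookup πs i) s (f s)) (sym (+-suc t (toℕ i))) (conforms⁻ πs c i)

conforms⁺ : ∀ {r f t} (πs : Vec Policy r) → (∀ i → Permits (lookup πs i) (t + toℕ i) (f (t + toℕ i))) →
            Conforms t πs f
conforms⁺ []       c = tt
conforms⁺ {f = f} {t} (π ∷ πs) c =
  subst (λ s → Permits π s (f s)) (+-identityʳ t) (c Fin.zero) ,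
  conforms⁺ πs (λ i → subst (λ s → Permits (lookup πs i) s (f s)) (+-suc t (toℕ i)) (c (Fin.suc i)))

partner : ∀ {m} → Vec (Fin m) m → ℕ → ℕ
partner {m} v i with i <? m
... | yes i<m = toℕ (lookup v (fromℕ< i<m))
... | no  _   = i

partner-toℕ : ∀ {m} (v : Vec (Fin m) m) i → partner v (toℕ i) ≡ toℕ (lookup v i)
partner-toℕ {m} v i with toℕ i <? m
... | yes i<m = cong (toℕ ∘ lookup v) (fromℕ<-toℕ i i<m)
... | no i≮m  = ⊥-elim (i≮m (toℕ<n i))

partner-outside : ∀ {m} (v : Vec (Fin m) m) {i} → m ≤ i → partner v i ≡ i
partner-outside {m} v {i} m≤i with i <? m
... | yes i<m = ⊥-elim (<⇒≱ i<m m≤i)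
... | no _    = refl

partner-arc : ∀ {m} (v : Vec (Fin m) m) {a} → a < partner v a →
              ∃ λ i → toℕ i ≡ a × MArc v i (lookup v i) × toℕ (lookup v i) ≡ partner v a
partner-arc {m} v {a} a<fa with a <? m
... | no _    = ⊥-elim (<-irrefl refl a<fa)
... | yes a<m = i , toℕ-fromℕ< a<m , (subst (_< toℕ (lookup v i)) (sym (toℕ-fromℕ< a<m)) a<fa , refl) , refl
  where i = fromℕ< a<m

lookup-injective : ∀ {A : Set} {n} {v w : Vec A n} → (∀ i → lookup v i ≡ lookup w i) → v ≡ w
lookup-injective {v = []}    {[]}    e = refl
lookup-injective {v = x ∷ v} {y ∷ w} e = cong₂ _∷_ (e Fin.zero) (lookup-injective (e ∘ Fin.suc))

module _ {m} (Π : Vec Policy m) where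

  PermittedInvolution : Vec (Fin m) m → Set
  PermittedInvolution v =
    (∀ i → lookup v (lookup v i) ≡ i) × (∀ i → Permits (lookup Π i) (toℕ i) (toℕ (lookup v i)))
    × Avoids (MArc v) p123 × Avoids (MArc v) p321

  partner-diagram : ∀ {v} → PermittedInvolution v → Diagram m (partner v)
  partner-diagram {v} (inv , _ , av123 , av321) = record
    { involutive = involutive ; outside = partner-outside v ; noCrossing = crossing ; noNesting = nesting }
    where
    involutive : ∀ i → partner v (partner v i) ≡ i
    involutive i with i <? m
    ... | no i≮m  = partner-outside v (≮⇒≥ i≮m)
    ... | yes i<m = trans (partner-toℕ v _) (trans (cong toℕ (inv (fromℕ< i<m))) (toℕ-fromℕ< i<m))
    crossing : ∀ {a b c} → a < b → b < c → c < partner v a → partner v a < partner v b →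
               partner v b < partner v c → ⊥
    crossing a<b b<c c<fa fa<fb fb<fc
      with partner-arc v (<-trans a<b (<-trans b<c c<fa))
         | partner-arc v (<-trans b<c (<-trans c<fa fa<fb))
         | partner-arc v (<-trans c<fa (<-trans fa<fb fb<fc))
    ... | i , refl , ad , p | j , refl , be , q | k , refl , cf , r =
      avoids-321⁻ (MArc v) av321 a<b b<c (subst (_ <_) (sym p) c<fa)
        (subst₂ _<_ (sym p) (sym q) fa<fb)
        (subst₂ _<_ (sym q) (sym r) fb<fc) ad be cf
    nesting : ∀ {a b c} → a < b → b < c → c < partner v c → partner v c < partner v b →
              partner v b < partner v a → ⊥
    nesting a<b b<c c<fc fc<fb fb<fa
      with partner-arc v (<-trans a<b (<-trans b<c (<-trans c<fc (<-trans fc<fb fb<fa))))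
         | partner-arc v (<-trans b<c (<-trans c<fc fc<fb))
         | partner-arc v c<fc
    ... | i , refl , af , p | j , refl , be , q | k , refl , cd , r =
      avoids-123⁻ (MArc v) av123 a<b b<c (subst (_ <_) (sym r) c<fc)
        (subst₂ _<_ (sym r) (sym q) fc<fb)
        (subst₂ _<_ (sym q) (sym p) fb<fa) af be cd

  partner-injective : ∀ {v w : Vec (Fin m) m} → (∀ i → partner v i ≡ partner w i) → v ≡ w
  partner-injective {v} {w} e = lookup-injective λ i →
    toℕ-injective (trans (sym (partner-toℕ v i)) (trans (e (toℕ i)) (partner-toℕ w i)))

  partner-surjective : ∀ {f} → Diagram m f → Conforms 0 Π f →
                       ∃ λ v → PermittedInvolution v × (∀ i → partner v i ≡ f i)
  partner-surjective {f} D conf = v , (inv , permits , av123 , av321) , partner≡f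
    where
    open Diagram D
    v : Vec (Fin m) m
    v = tabulate (λ i → fromℕ< (bounded (toℕ<n i)))
    v≡f : ∀ i → toℕ (lookup v i) ≡ f (toℕ i)
    v≡f i = trans (cong toℕ (lookup∘tabulate _ i)) (toℕ-fromℕ< _)
    inv : ∀ i → lookup v (lookup v i) ≡ i
    inv i = toℕ-injective (trans (v≡f _) (trans (cong f (v≡f i)) (involutive _)))
    permits : ∀ i → Permits (lookup Π i) (toℕ i) (toℕ (lookup v i))
    permits i = subst (Permits (lookup Π i) (toℕ i)) (sym (v≡f i)) (conforms⁻ Π conf i)
    arc : ∀ {i j} → MArc v i j → toℕ j ≡ f (toℕ i)
    arc (_ , refl) = v≡f _
    av321 : Avoids (MArc v) p321
    av321 = avoids-321⁺ (MArc v) λ ab bc cd de ef ad be cf →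
      noCrossing ab bc (subst (_ <_) (arc ad) cd)
        (subst₂ _<_ (arc ad) (arc be) de)
        (subst₂ _<_ (arc be) (arc cf) ef)
    av123 : Avoids (MArc v) p123
    av123 = avoids-123⁺ (MArc v) λ ab bc cd de ef af be cd′ →
      noNesting ab bc (subst (_ <_) (arc cd′) cd)
        (subst₂ _<_ (arc cd′) (arc be) de)
        (subst₂ _<_ (arc be) (arc af) ef)
    partner≡f : ∀ i → partner v i ≡ f i
    partner≡f i with i <? m
    ... | no i≮m  = sym (outside (≮⇒≥ i≮m))
    ... | yes i<m = trans (v≡f _) (cong f (toℕ-fromℕ< i<m))

  involutions-size : PermittedInvolution HasSize completions Π 0
  involutions-size = Enumeration.enumerated PermittedInvolution partner Π partner-diagram
    (λ {v} (_ , permits , _) → conforms⁺ Π (λ i →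
      subst (Permits (lookup Π i) (toℕ i)) (sym (partner-toℕ v i)) (permits i)))
    (λ _ _ → partner-injective) partner-surjective

forced : Bool → Policy
forced b = policy (not b) false b

unfixed : Policy
unfixed = policy true false true

permits-forced : ∀ {m} (i j : Fin m) → j ≢ i → Permits (forced ⌊ i Fin.<? j ⌋) (toℕ i) (toℕ j)
permits-forced i j j≢i with i Fin.<? j
... | yes i<j = (λ j<i → ⊥-elim (<-asym i<j j<i)) , (λ e → ⊥-elim (j≢i (toℕ-injective e))) , λ _ → tt
... | no i≮j  = (λ _ → tt) , (λ e → ⊥-elim (j≢i (toℕ-injective e))) , (λ i<j → ⊥-elim (i≮j i<j))

permits-forced⁻ : ∀ {m} b (i j : Fin m) → Permits (forced b) (toℕ i) (toℕ j) → j ≢ i × ⌊ i Fin.<? j ⌋ ≡ b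
permits-forced⁻ b i j (p< , p≡ , p>) = (λ e → p≡ (cong toℕ e)) , shape≡
  where
  T⇒≡ : ∀ {b} → T b → true ≡ b
  T⇒≡ {true} _ = refl
  T-not⇒≡ : ∀ {b} → T (not b) → false ≡ b
  T-not⇒≡ {false} _ = refl
  shape≡ : ⌊ i Fin.<? j ⌋ ≡ b
  shape≡ with i Fin.<? j
  ... | yes i<j = T⇒≡ (p> i<j)
  ... | no i≮j  = T-not⇒≡ (p< (≤∧≢⇒< (≮⇒≥ i≮j) p≡))

#MF-completions : ∀ n w → #MF n w p123 p321 ≡ completions (Vec.map forced w) 0
#MF-completions n w = countVec-size sumFin-summation _≟ᶠ_ (MF? w p123 p321)
  (size-⇔ {P = PermittedInvolution (Vec.map forced w)}
    (λ {v} (inv , ok , av , av′) →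
      let ok′ i = permits-forced⁻ (lookup w i) i (lookup v i)
                    (subst (λ π → Permits π (toℕ i) (toℕ (lookup v i))) (lookup-map i forced w) (ok i))
      in (λ i → inv i , proj₁ (ok′ i)) ,
         lookup-injective (λ i → trans (lookup∘tabulate _ i) (proj₂ (ok′ i))) , av , av′)
    (λ { {v} (match , refl , av , av′) → proj₁ ∘ match ,
      (λ i → subst (λ π → Permits π (toℕ i) (toℕ (lookup v i)))
        (sym (trans (lookup-map i forced (shape v)) (cong forced (lookup∘tabulate _ i))))
        (permits-forced i (lookup v i) (proj₂ (match i)))) , av , av′ })
    (involutions-size (Vec.map forced w)))

#Mn-completions : ∀ n → #Mn n p123 p321 ≡ completions (replicate (2 * n) unfixed) 0
#Mn-completions n = countVec-size sumFin-summation _≟ᶠ_ (Mn? p123 p321)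
  (size-⇔ {P = PermittedInvolution (replicate (2 * n) unfixed)}
    (λ {v} (inv , ok , av , av′) →
      (λ i → inv i , λ e → proj₁ (proj₂ (subst (λ π → Permits π (toℕ i) (toℕ (lookup v i)))
                                           (lookup-replicate i unfixed) (ok i))) (cong toℕ e)) , av , av′)
    (λ {v} (match , av , av′) → proj₁ ∘ match ,
      (λ i → subst (λ π → Permits π (toℕ i) (toℕ (lookup v i))) (sym (lookup-replicate i unfixed))
        ((λ _ → tt) , (λ e → proj₂ (match i) (toℕ-injective e)) , (λ _ → tt))) , av , av′)
    (involutions-size (replicate (2 * n) unfixed)))

-- Set partitions as diagrams

-- Vertex i of a partition becomes two slots: i is first the end of an arc, then the start of one.
endSlot startSlot : ℕ → ℕ
endSlot i   = i * 2
startSlot i = suc (i * 2)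

endSlot≢startSlot : ∀ i j → endSlot i ≢ startSlot j
endSlot≢startSlot (suc i) (suc j) e = endSlot≢startSlot i j (suc-injective (suc-injective e))

endSlot-injective : ∀ {i j} → endSlot i ≡ endSlot j → i ≡ j
endSlot-injective {i} {j} = *-cancelʳ-≡ i j 2

startSlot-injective : ∀ {i j} → startSlot i ≡ startSlot j → i ≡ j
startSlot-injective e = endSlot-injective (suc-injective e)

endSlot-cancel-< : ∀ {i j} → endSlot i < endSlot j → i < j
endSlot-cancel-< {i} {j} = *-cancelʳ-< 2 i j

startSlot-cancel-< : ∀ {i j} → startSlot i < startSlot j → i < j
startSlot-cancel-< (s≤s lt) = endSlot-cancel-< lt

start<end : ∀ {i j} → i < j → startSlot i < endSlot j
start<end = *-monoˡ-≤ 2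

-- The end slot of a vertex precedes its start slot, so two arcs that meet in a vertex do not cross
-- as chords. This matches the six distinct positions of a pattern.
start<end⁻ : ∀ {i j} → startSlot i < endSlot j → i < j
start<end⁻ lt = endSlot-cancel-< (<-trans (n<1+n _) lt)

end<end : ∀ {i j} → i < j → endSlot i < endSlot j
end<end i<j = <-trans (n<1+n _) (start<end i<j)

parity : ∀ s → ∃ λ i → s ≡ endSlot i ⊎ s ≡ startSlot i
parity zero = 0 , inj₁ refl
parity (suc zero) = 0 , inj₂ refl
parity (suc (suc s)) with parity s
... | i , inj₁ e = suc i , inj₁ (cong (suc ∘ suc) e)
... | i , inj₂ e = suc i , inj₂ (cong (suc ∘ suc) e)

half-startSlot : ∀ i → ℕ.⌊ startSlot i /2⌋ ≡ i
half-startSlot zero    = refl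
half-startSlot (suc i) = cong suc (half-startSlot i)

endPolicy startPolicy : Policy
endPolicy   = policy true true false
startPolicy = policy false true true

alternating : ∀ n → Vec Policy (n * 2)
alternating zero    = []
alternating (suc n) = endPolicy ∷ startPolicy ∷ alternating n

Alternates : (ℕ → ℕ) → ℕ → Set
Alternates f i =
  Permits endPolicy (endSlot i) (f (endSlot i)) × Permits startPolicy (startSlot i) (f (startSlot i))

alternates⇒conforms : ∀ {f} n k → (∀ i → Alternates f i) → Conforms (k * 2) (alternating n) f
alternates⇒conforms zero    k alt = tt
alternates⇒conforms (suc n) k alt =
  proj₁ (alt k) , proj₂ (alt k) , alternates⇒conforms n (suc k) alt

conforms⇒alternates : ∀ {f} n k → Conforms (k * 2) (alternating n) f → ∀ {i} → k ≤ i → i < k + n → Alternates f i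
conforms⇒alternates zero    k c k≤i i<k+n =
  ⊥-elim (<⇒≱ i<k+n (subst (_≤ _) (sym (+-identityʳ k)) k≤i))
conforms⇒alternates (suc n) k (p , q , c) {i} k≤i i<k+n with k ≟ i
... | yes refl = p , q
... | no k≢i = conforms⇒alternates n (suc k) c (≤∧≢⇒< k≤i k≢i) (subst (i <_) (+-suc k n) i<k+n)

module _ {n} (R : Rel n) where

  data Chord (s : ℕ) : Set where
    start : ∀ {i j} → PArc R i j → s ≡ startSlot (toℕ i) → Chord s
    end   : ∀ {i j} → PArc R i j → s ≡ endSlot (toℕ j) → Chord s
    idle  : (∀ {i j} → PArc R i j → s ≢ startSlot (toℕ i)) → (∀ {i j} → PArc R i j → s ≢ endSlot (toℕ j)) →
            Chord s

  chord : ∀ s → Chord s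
  chord s with any? (λ i → any? (λ j → PArc? R i j ×-dec (s ≟ startSlot (toℕ i))))
             | any? (λ i → any? (λ j → PArc? R i j ×-dec (s ≟ endSlot (toℕ j))))
  ... | yes (i , j , arc , e) | _ = start arc e
  ... | no _ | yes (i , j , arc , e) = end arc e
  ... | no ¬start | no ¬end = idle (λ arc e → ¬start (_ , _ , arc , e)) (λ arc e → ¬end (_ , _ , arc , e))

  other-end : ∀ {s} → Chord s → ℕ
  other-end (start {j = j} _ _) = endSlot (toℕ j)
  other-end (end {i = i} _ _)   = startSlot (toℕ i)
  other-end {s} (idle _ _)      = s

  chords : ℕ → ℕ
  chords s = other-end (chord s)

module _ {n} (R : Rel n) (partition : IsPartition R) where
  private
    reflexive  = proj₁ partition
    symmetric  = proj₁ (proj₂ partition)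
    transitive = proj₂ (proj₂ partition)

  arc-target-unique : ∀ {i j j′} → PArc R i j → PArc R i j′ → j ≡ j′
  arc-target-unique {i} {j} {j′} (i<j , r , gap) (i<j′ , r′ , gap′) with <-cmp (toℕ j) (toℕ j′)
  ... | tri< lt _ _ = ⊥-elim (gap′ j i<j lt r)
  ... | tri≈ _ e _  = toℕ-injective e
  ... | tri> _ _ gt = ⊥-elim (gap j′ i<j′ gt r′)

  arc-source-unique : ∀ {i i′ j} → PArc R i j → PArc R i′ j → i ≡ i′
  arc-source-unique {i} {i′} {j} (i<j , r , gap) (i′<j , r′ , gap′) with <-cmp (toℕ i) (toℕ i′)
  ... | tri< lt _ _ = ⊥-elim (gap i′ lt i′<j (transitive i j i′ r (symmetric i′ j r′)))
  ... | tri≈ _ e _  = toℕ-injective e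
  ... | tri> _ _ gt = ⊥-elim (gap′ i gt i<j (transitive i′ j i r′ (symmetric i j r)))

  chords-start : ∀ {i j} → PArc R i j → chords R (startSlot (toℕ i)) ≡ endSlot (toℕ j)
  chords-start {i} {j} arc with chord R (startSlot (toℕ i))
  ... | end {j = j′} _ e = ⊥-elim (endSlot≢startSlot (toℕ j′) (toℕ i) (sym e))
  ... | idle ¬start _    = ⊥-elim (¬start arc refl)
  ... | start {i′} arc′ e with toℕ-injective {i = i} {i′} (startSlot-injective e)
  ... | refl = cong (endSlot ∘ toℕ) (arc-target-unique arc′ arc)

  chords-end : ∀ {i j} → PArc R i j → chords R (endSlot (toℕ j)) ≡ startSlot (toℕ i)
  chords-end {i} {j} arc with chord R (endSlot (toℕ j))
  ... | start {i = i′} _ e = ⊥-elim (endSlot≢startSlot (toℕ j) (toℕ i′) e)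
  ... | idle _ ¬end        = ⊥-elim (¬end arc refl)
  ... | end {j = j′} arc′ e with toℕ-injective {i = j} {j′} (endSlot-injective e)
  ... | refl = cong (startSlot ∘ toℕ) (arc-source-unique arc′ arc)

  chords-involutive : ∀ s → chords R (chords R s) ≡ s
  chords-involutive s with chord R s in eq
  ... | start arc refl = chords-end arc
  ... | end arc refl   = chords-start arc
  ... | idle _ _       = cong (other-end R) eq

  chords-outside : ∀ {s} → n * 2 ≤ s → chords R s ≡ s
  chords-outside {s} n≤s with chord R s
  ... | start {i} _ refl  = ⊥-elim (<⇒≱ (start<end (toℕ<n i)) n≤s)
  ... | end {j = j} _ refl = ⊥-elim (<⇒≱ (end<end (toℕ<n j)) n≤s)
  ... | idle _ _          = refl

  chords-arc : ∀ {s} → s < chords R s →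
               ∃ λ i → ∃ λ j → s ≡ startSlot (toℕ i) × chords R s ≡ endSlot (toℕ j) × PArc R i j
  chords-arc {s} lt with chord R s
  ... | start {i} {j} arc e = i , j , e , refl , arc
  ... | end {i} {j} arc refl = ⊥-elim (<-asym lt (start<end (proj₁ arc)))
  ... | idle _ _ = ⊥-elim (<-irrefl refl lt)

  chords-diagram : Avoids (PArc R) p123 → Avoids (PArc R) p321 → Diagram (n * 2) (chords R)
  chords-diagram av123 av321 = record
    { involutive = chords-involutive ; outside = chords-outside ; noCrossing = crossing ; noNesting = nesting }
    where
    crossing : ∀ {a b c} → a < b → b < c → c < chords R a → chords R a < chords R b →
               chords R b < chords R c → ⊥
    crossing a<b b<c c<fa fa<fb fb<fc
      with chords-arc (<-trans a<b (<-trans b<c c<fa))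
         | chords-arc (<-trans b<c (<-trans c<fa fa<fb))
         | chords-arc (<-trans c<fa (<-trans fa<fb fb<fc))
    ... | i , i′ , refl , p , ii′ | j , j′ , refl , q , jj′ | k , k′ , refl , r , kk′ =
      avoids-321⁻ (PArc R) av321 (startSlot-cancel-< a<b) (startSlot-cancel-< b<c)
        (start<end⁻ (subst (_ <_) p c<fa))
        (endSlot-cancel-< (subst₂ _<_ p q fa<fb))
        (endSlot-cancel-< (subst₂ _<_ q r fb<fc)) ii′ jj′ kk′
    nesting : ∀ {a b c} → a < b → b < c → c < chords R c → chords R c < chords R b →
              chords R b < chords R a → ⊥
    nesting a<b b<c c<fc fc<fb fb<fa
      with chords-arc (<-trans a<b (<-trans b<c (<-trans c<fc (<-trans fc<fb fb<fa))))
         | chords-arc (<-trans b<c (<-trans c<fc fc<fb))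
         | chords-arc c<fc
    ... | i , i′ , refl , p , ii′ | j , j′ , refl , q , jj′ | k , k′ , refl , r , kk′ =
      avoids-123⁻ (PArc R) av123 (startSlot-cancel-< a<b) (startSlot-cancel-< b<c)
        (start<end⁻ (subst (_ <_) r c<fc))
        (endSlot-cancel-< (subst₂ _<_ r q fc<fb))
        (endSlot-cancel-< (subst₂ _<_ q p fb<fa)) ii′ jj′ kk′

  chords-alternate : ∀ i → Alternates (chords R) i
  chords-alternate i = at-end , at-start
    where
    at-end : Permits endPolicy (endSlot i) (chords R (endSlot i))
    at-end with chord R (endSlot i)
    ... | start {i = i′} _ e = ⊥-elim (endSlot≢startSlot i (toℕ i′) e)
    ... | end {k} arc e = (λ _ → tt) , (λ _ → tt) ,
      (λ lt → ⊥-elim (<-asym lt (subst (startSlot (toℕ k) <_) (sym e) (start<end (proj₁ arc)))))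
    ... | idle _ _ = (λ _ → tt) , (λ _ → tt) , (λ lt → ⊥-elim (<-irrefl refl lt))
    at-start : Permits startPolicy (startSlot i) (chords R (startSlot i))
    at-start with chord R (startSlot i)
    ... | start {j = j} arc e = (λ lt → ⊥-elim (<-asym lt (subst (_< endSlot (toℕ j)) (sym e) (start<end (proj₁ arc)))))
      , (λ _ → tt) , (λ _ → tt)
    ... | end {j = j} _ e = ⊥-elim (endSlot≢startSlot (toℕ j) i (sym e))
    ... | idle _ _ = (λ lt → ⊥-elim (<-irrefl refl lt)) , (λ _ → tt) , (λ _ → tt)

  -- The arc into `j` starts at the largest block member below `j`. The search moves `i` upwards
  -- through the block, with the distance to `j` as its bound.
  last-arc : ∀ {i j} → i Fin.< j → i ∼[ R ] j → ∃ λ p → PArc R p j × i Fin.≤ p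
  last-arc {i} {j} = go (toℕ j) (m≤n+m (toℕ j) (toℕ i))
    where
    go : ∀ k {i} → toℕ j ≤ toℕ i + k → i Fin.< j → i ∼[ R ] j → ∃ λ p → PArc R p j × i Fin.≤ p
    go zero {i} j≤i i<j r = ⊥-elim (<⇒≱ i<j (subst (toℕ j ≤_) (+-identityʳ (toℕ i)) j≤i))
    go (suc k) {i} j≤ i<j r
      with any? (λ l → (i Fin.<? l) ×-dec (l Fin.<? j) ×-dec (lookup (lookup R i) l ≟ᵇ true))
    ... | no none-between = i , (i<j , r , λ l i<l l<j il → none-between (l , i<l , l<j , il)) , ≤-refl
    ... | yes (l , i<l , l<j , il) =
      let p , arc , l≤p = go k (≤-trans j≤ (≤-trans (≤-reflexive (+-suc (toℕ i) k)) (+-monoˡ-≤ k i<l)))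
                             l<j (transitive l i j (symmetric i l il) r)
      in p , arc , ≤-trans (<⇒≤ i<l) l≤p

-- A partition is generated by its arcs: `i` is linked to `j` through the predecessor `p` of `j` in
-- its block, by induction on the larger element.
arcs-determine-⊆ : ∀ {n} (R R′ : Rel n) → IsPartition R → IsPartition R′ →
                   (∀ {i j} → PArc R i j → PArc R′ i j) → ∀ i j → i ∼[ R ] j → i ∼[ R′ ] j
arcs-determine-⊆ {n} R R′ partition@(_ , symm , trns) (rfl′ , symm′ , trns′) arcs i j r =
  by-order (<-cmp (toℕ i) (toℕ j))
  where
  go : ∀ k {i j} → toℕ j < k → i Fin.< j → i ∼[ R ] j → i ∼[ R′ ] j
  go (suc k) {i} {j} (s≤s j≤k) i<j r with last-arc R partition i<j r
  ... | p , arc , i≤p with i ≟ᶠ p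
  ...   | yes refl = proj₁ (proj₂ (arcs arc))
  ...   | no i≢p   = trns′ i p j
    (go k (<-≤-trans (proj₁ arc) j≤k) (≤∧≢⇒< i≤p (i≢p ∘ toℕ-injective))
      (trns i j p r (symm p j (proj₁ (proj₂ arc)))))
    (proj₁ (proj₂ (arcs arc)))
  by-order : Tri (i Fin.< j) (toℕ i ≡ toℕ j) (j Fin.< i) → i ∼[ R′ ] j
  by-order (tri< lt _ _) = go n (toℕ<n j) lt r
  by-order (tri≈ _ e _)  = subst (i ∼[ R′ ]_) (toℕ-injective e) (rfl′ i)
  by-order (tri> _ _ gt) = symm′ j i (go n (toℕ<n i) gt (symm i j r))

chords-injective : ∀ {n} {R R′ : Rel n} → IsPartition R → IsPartition R′ →
                   (∀ s → chords R s ≡ chords R′ s) → R ≡ R′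
chords-injective {R = R} {R′} part part′ e = lookup-injective λ i → lookup-injective λ j →
  iff⇒≡ (arcs-determine-⊆ R R′ part part′ (transfer R R′ part part′ e) i j)
        (arcs-determine-⊆ R′ R part′ part (transfer R′ R part′ part (sym ∘ e)) i j)
  where
  iff⇒≡ : ∀ {b c : Bool} → (b ≡ true → c ≡ true) → (c ≡ true → b ≡ true) → b ≡ c
  iff⇒≡ {true}          f g = sym (f refl)
  iff⇒≡ {false} {true}  f g = g refl
  iff⇒≡ {false} {false} f g = refl
  transfer : ∀ {n} (R R′ : Rel n) → IsPartition R → IsPartition R′ →
             (∀ s → chords R s ≡ chords R′ s) → ∀ {i j} → PArc R i j → PArc R′ i j
  transfer R R′ part part′ e {i} {j} arc
    with chords-arc R′ part′ {startSlot (toℕ i)} (subst (startSlot (toℕ i) <_) (sym value) (start<end (proj₁ arc)))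
    where
    value : chords R′ (startSlot (toℕ i)) ≡ endSlot (toℕ j)
    value = trans (sym (e _)) (chords-start R part arc)
  ... | i′ , j′ , p , q , arc′
    with toℕ-injective {i = i} {i′} (startSlot-injective p)
       | toℕ-injective {i = j′} {j} (endSlot-injective (trans (sym q) (trans (sym (e _)) (chords-start R part arc))))
  ... | refl | refl = arc′

-- The partition belonging to a diagram

module FromDiagram {n f} (D : Diagram (n * 2) f) (conf : Conforms 0 (alternating n) f) where
  open Diagram D

  private
    alternates : ∀ {i} → i < n → Alternates f i
    alternates = conforms⇒alternates n 0 conf z≤n

    slot-bound : ∀ i {s} → i * 2 ≤ s → s < n * 2 → i < n
    slot-bound i i≤s s<n = endSlot-cancel-< (≤-<-trans i≤s s<n)

  Joined : ℕ → ℕ → Set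
  Joined i j = i < j × f (endSlot j) ≡ startSlot i

  -- One step back along an arc. The first member of a block is its own predecessor, so that
  -- iteration becomes stationary.
  previous : ℕ → ℕ
  previous j with f (endSlot j) <? endSlot j
  ... | yes _ = ℕ.⌊ f (endSlot j) /2⌋
  ... | no _  = j

  data Previous (j : ℕ) : Set where
    first  : previous j ≡ j → f (endSlot j) ≡ endSlot j → Previous j
    joined : Joined (previous j) j → Previous j

  previous-view : ∀ {j} → j < n → Previous j
  previous-view {j} j<n with f (endSlot j) <? endSlot j in eq
  ... | no ≮ = first prev≡ (≤-antisym (≮⇒≥ not-opener) (≮⇒≥ ≮))
    where
    not-opener : ¬ endSlot j < f (endSlot j)
    not-opener = proj₂ (proj₂ (proj₁ (alternates j<n)))
    prev≡ : previous j ≡ j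
    prev≡ rewrite eq = refl
  ... | yes lt with parity (f (endSlot j))
  -- If the partner were an end slot, it would open the arc, which `endPolicy` forbids.
  ...   | i , inj₁ e = ⊥-elim (proj₂ (proj₂ (proj₁ (alternates i<n))) opener-at-end)
    where
    i<n : i < n
    i<n = slot-bound i (≤-reflexive (sym e)) (bounded (end<end j<n))
    opener-at-end : endSlot i < f (endSlot i)
    opener-at-end = subst (λ s → s < f s) e (subst (f (endSlot j) <_) (sym (involutive _)) lt)
  ...   | i , inj₂ e = joined (subst (λ k → Joined k j) (sym prev≡)
                                (start<end⁻ (subst (_< endSlot j) e lt) , e))
    where
    prev≡ : previous j ≡ i
    prev≡ rewrite eq = trans (cong ℕ.⌊_/2⌋ e) (half-startSlot i)

  previous-joined : ∀ {i j} → Joined i j → previous j ≡ i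
  previous-joined {i} {j} (i<j , e) with f (endSlot j) <? endSlot j
  ... | yes _ = trans (cong ℕ.⌊_/2⌋ e) (half-startSlot i)
  ... | no ≮  = ⊥-elim (≮ (subst (_< endSlot j) (sym e) (start<end i<j)))

  joined-unique : ∀ {i j j′} → Joined i j → Joined i j′ → j ≡ j′
  joined-unique (_ , e) (_ , e′) = endSlot-injective (injective (trans e (sym e′)))

  ancestor : ℕ → ℕ → ℕ
  ancestor zero    j = j
  ancestor (suc k) j = ancestor k (previous j)

  ancestor-first : ∀ k {j} → previous j ≡ j → ancestor k j ≡ j
  ancestor-first zero    e = refl
  ancestor-first (suc k) e = trans (cong (ancestor k) e) (ancestor-first k e)

  ancestor-previous : ∀ k j → ancestor k (previous j) ≡ previous (ancestor k j)
  ancestor-previous zero    j = refl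
  ancestor-previous (suc k) j = ancestor-previous k (previous j)

  -- Each proper step back lowers the vertex, so at most `j` steps lead to the first member of the
  -- block.
  ancestor-stable : ∀ k {j} → j ≤ k → j < n → previous (ancestor k j) ≡ ancestor k j
  ancestor-stable k {j} j≤k j<n with previous-view j<n
  ... | first e _ = subst (λ i → previous i ≡ i) (sym (ancestor-first k e)) e
  ancestor-stable zero    z≤n j<n | joined ()
  ancestor-stable (suc k) j≤k j<n | joined (p<j , _) =
    ancestor-stable k (≤-pred (<-≤-trans p<j j≤k)) (<-trans p<j j<n)

  ancestor-≤ : ∀ k {j} → j < n → ancestor k j ≤ j
  ancestor-≤ zero    j<n = ≤-refl
  ancestor-≤ (suc k) {j} j<n with previous-view j<n
  ... | first e _        = ≤-reflexive (ancestor-first (suc k) e)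
  ... | joined (p<j , _) = ≤-trans (ancestor-≤ k (<-trans p<j j<n)) (<⇒≤ p<j)

  root : ℕ → ℕ
  root = ancestor n

  root-previous : ∀ {j} → j < n → root (previous j) ≡ root j
  root-previous {j} j<n = trans (ancestor-previous n j) (ancestor-stable n (<⇒≤ j<n) j<n)

  root-joined : ∀ {i j} → j < n → Joined i j → root i ≡ root j
  root-joined j<n J = trans (cong root (sym (previous-joined J))) (root-previous j<n)

  -- A block member strictly between previous j and j would, going back, have to pass through
  -- previous j, whose only successor is j.
  root-≤-previous : ∀ k {i j} → j < k → j < n → i < j → root i ≡ root j → Joined (previous j) j × i ≤ previous j
  root-≤-previous (suc k) {i} {j} (s≤s j≤k) j<n i<j ri≡rj with previous-view j<n
  ... | first e _ = ⊥-elim (<⇒≱ i<j (subst (_≤ i) (trans ri≡rj (ancestor-first n e)) (ancestor-≤ n (<-trans i<j j<n))))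
  ... | joined J = J , ≮⇒≥ (λ p<i → between k (<-≤-trans i<j j≤k) p<i i<j (trans (root-previous j<n) (sym ri≡rj)))
    where
    between : ∀ k′ {i} → i < k′ → previous j < i → i < j → root (previous j) ≡ root i → ⊥
    between (suc k′) {i} (s≤s i≤k′) p<i i<j rp≡ri
      with root-≤-previous k (<-≤-trans i<j j≤k) (<-trans i<j j<n) p<i rp≡ri
    ... | J′ , p≤q with previous j ≟ previous i
    ...   | yes e = <-irrefl (joined-unique J′ (subst (λ q → Joined q j) e J)) i<j
    ...   | no p≢q = between k′ (<-≤-trans (proj₁ J′) i≤k′) (≤∧≢⇒< p≤q p≢q) (<-trans (proj₁ J′) i<j)
      (trans rp≡ri (sym (root-previous (<-trans i<j j<n))))

  -- Comparison of roots decides the equivalence generated by `Joined` and makes its three laws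
  -- immediate.
  relation : Rel n
  relation = tabulate λ i → tabulate λ j → ⌊ root (toℕ i) ≟ root (toℕ j) ⌋

  lookup-relation : ∀ i j → lookup (lookup relation i) j ≡ ⌊ root (toℕ i) ≟ root (toℕ j) ⌋
  lookup-relation i j = trans (cong (λ row → lookup row j) (lookup∘tabulate _ i)) (lookup∘tabulate _ j)

  related⁺ : ∀ {i j} → root (toℕ i) ≡ root (toℕ j) → i ∼[ relation ] j
  related⁺ {i} {j} e = trans (lookup-relation i j) true≡
    where
    true≡ : ⌊ root (toℕ i) ≟ root (toℕ j) ⌋ ≡ true
    true≡ with root (toℕ i) ≟ root (toℕ j)
    ... | yes _ = refl
    ... | no ≢  = ⊥-elim (≢ e)

  related⁻ : ∀ {i j} → i ∼[ relation ] j → root (toℕ i) ≡ root (toℕ j)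
  related⁻ {i} {j} r with root (toℕ i) ≟ root (toℕ j) | trans (sym (lookup-relation i j)) r
  ... | yes e | _ = e
  ... | no _ | ()

  relation-partition : IsPartition relation
  relation-partition =
    (λ i → related⁺ refl) ,
    (λ i j r → related⁺ (sym (related⁻ r))) ,
    (λ i j k r s → related⁺ (trans (related⁻ r) (related⁻ s)))

  -- If the source of the arc were not `previous j`, it would lie before it, and `previous j` would
  -- be a block member strictly between the ends of the arc.
  arc⇒joined : ∀ {i j} → PArc relation i j → Joined (toℕ i) (toℕ j)
  arc⇒joined {i} {j} (i<j , r , gap) with root-≤-previous n (toℕ<n j) (toℕ<n j) i<j (related⁻ r)
  ... | J , i≤p with toℕ i ≟ previous (toℕ j)
  ...   | yes e = subst (λ k → Joined k (toℕ j)) (sym e) J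
  ...   | no i≢p = ⊥-elim (gap p (subst (toℕ i <_) (sym p≡) (≤∧≢⇒< i≤p i≢p)) (subst (_< toℕ j) (sym p≡) (proj₁ J))
    (related⁺ (trans (related⁻ r) (trans (sym (root-previous (toℕ<n j))) (cong root (sym p≡))))))
    where
    p<n = <-trans (proj₁ J) (toℕ<n j)
    p : Fin n
    p = fromℕ< p<n
    p≡ : toℕ p ≡ previous (toℕ j)
    p≡ = toℕ-fromℕ< p<n

  joined⇒arc : ∀ {i j} → Joined (toℕ i) (toℕ j) → PArc relation i j
  joined⇒arc {i} {j} J@(i<j , _) = i<j , related⁺ (root-joined (toℕ<n j) J) , gap
    where
    gap : ∀ k → i Fin.< k → k Fin.< j → ¬ i ∼[ relation ] k
    gap k i<k k<j r = <⇒≱ i<k (subst (toℕ k ≤_) (previous-joined J) (proj₂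
      (root-≤-previous n (toℕ<n j) (toℕ<n j) k<j (trans (sym (related⁻ r)) (root-joined (toℕ<n j) J)))))

  joined⇒arc-< : ∀ {i j} → j < n → Joined i j → ∃ λ i′ → ∃ λ j′ → toℕ i′ ≡ i × toℕ j′ ≡ j × PArc relation i′ j′
  joined⇒arc-< {i} {j} j<n J@(i<j , _) = fromℕ< i<n , fromℕ< j<n , toℕ-fromℕ< i<n , toℕ-fromℕ< j<n ,
    joined⇒arc (subst (λ i → Joined i _) (sym (toℕ-fromℕ< i<n)) (subst (Joined i) (sym (toℕ-fromℕ< j<n)) J))
    where i<n = <-trans i<j j<n

  arc-start : ∀ {i j} → PArc relation i j → f (startSlot (toℕ i)) ≡ endSlot (toℕ j)
  arc-start arc = trans (cong f (sym (proj₂ (arc⇒joined arc)))) (involutive _)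

  relation-avoids-321 : Avoids (PArc relation) p321
  relation-avoids-321 = avoids-321⁺ (PArc relation) λ ab bc cd de ef ad be cf →
    noCrossing (s≤s (end<end ab)) (s≤s (end<end bc)) (subst (_ <_) (sym (arc-start ad)) (start<end cd))
      (subst₂ _<_ (sym (arc-start ad)) (sym (arc-start be)) (end<end de))
      (subst₂ _<_ (sym (arc-start be)) (sym (arc-start cf)) (end<end ef))

  relation-avoids-123 : Avoids (PArc relation) p123
  relation-avoids-123 = avoids-123⁺ (PArc relation) λ ab bc cd de ef af be cd′ →
    noNesting (s≤s (end<end ab)) (s≤s (end<end bc)) (subst (_ <_) (sym (arc-start cd′)) (start<end cd))
      (subst₂ _<_ (sym (arc-start cd′)) (sym (arc-start be)) (end<end de))
      (subst₂ _<_ (sym (arc-start be)) (sym (arc-start af)) (end<end ef))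

  chords≡ : ∀ s → chords relation s ≡ f s
  chords≡ s with chord relation s
  ... | start arc refl = sym (arc-start arc)
  ... | end arc refl = sym (proj₂ (arc⇒joined arc))
  -- A slot without a chord has to be fixed by `f`: by parity and the policies, any other partner
  -- would yield a `Joined` pair and hence an arc.
  ... | idle ¬start ¬end with s <? n * 2
  ...   | no s≮ = sym (outside (≮⇒≥ s≮))
  ...   | yes s< with parity s
  ...     | j , inj₁ refl = at-end (previous-view j<n)
    where
    j<n = slot-bound j ≤-refl s<
    at-end : Previous j → endSlot j ≡ f (endSlot j)
    at-end (first _ e) = sym e
    at-end (joined J) =
      let _ , _ , _ , q , arc = joined⇒arc-< j<n J in ⊥-elim (¬end arc (cong endSlot (sym q)))
  ...     | i , inj₂ refl = sym at-start
    where
    i<n = slot-bound i (n≤1+n _) s<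
    at-start : f (startSlot i) ≡ startSlot i
    at-start with <-cmp (f (startSlot i)) (startSlot i)
    ... | tri< lt _ _ = ⊥-elim (proj₁ (proj₂ (alternates i<n)) lt)
    ... | tri≈ _ e _  = e
    ... | tri> _ _ gt with parity (f (startSlot i))
    ...   | j , inj₁ e = ⊥-elim (¬start arc (cong startSlot (sym p)))
      where
      j<n = slot-bound j (≤-reflexive (sym e)) (bounded s<)
      J : Joined i j
      J = start<end⁻ (subst (startSlot i <_) e gt) , trans (cong f (sym e)) (involutive _)
      arc = proj₂ (proj₂ (proj₂ (proj₂ (joined⇒arc-< j<n J))))
      p = proj₁ (proj₂ (proj₂ (joined⇒arc-< j<n J)))
    ...   | j , inj₂ e = ⊥-elim (proj₁ (proj₂ (alternates j<n))
      (subst (λ t → f t < t) e (subst (_< f (startSlot i)) (sym (involutive _)) gt)))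
      where
      j<n = slot-bound j (≤-trans (n≤1+n _) (≤-reflexive (sym e))) (bounded s<)

#Pn-completions : ∀ n → #Pn n p123 p321 ≡ completions (alternating n) 0
#Pn-completions n = countVec-size (sumVec-summation sumBool-summation n) (≡-dec _≟ᵇ_) (Pn? p123 p321)
  (Enumeration.enumerated _ chords (alternating n)
    (λ {R} (part , av123 , av321) → chords-diagram R part av123 av321)
    (λ {R} (part , _) → alternates⇒conforms n 0 (chords-alternate R part))
    (λ (part , _) (part′ , _) → chords-injective part part′)
    (λ D conf → let open FromDiagram D conf in
      relation , (relation-partition , relation-avoids-123 , relation-avoids-321) , chords≡))

-- Matchings of a given shape: heights of the border

-- The factor gained on arrival at a height, which lets `upward` and `downward` be treated
-- uniformly.
scale : ℕ → ℕ
scale 2 = 2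
scale _ = 1

upward-scale : ∀ g {h} → h < 4 → upward g h ≡ scale (suc h) * g (suc h)
upward-scale g {0} _ = sym (+-identityʳ _)
upward-scale g {1} _ = refl
upward-scale g {2} _ = sym (+-identityʳ _)
upward-scale g {3} _ = sym (+-identityʳ _)
upward-scale g {suc (suc (suc (suc h)))} (s≤s (s≤s (s≤s (s≤s ()))))

downward-scale : ∀ g {h} → h < 4 → downward g (suc h) ≡ scale h * g h
downward-scale g {0} _ = sym (+-identityʳ _)
downward-scale g {1} _ = sym (+-identityʳ _)
downward-scale g {2} _ = refl
downward-scale g {3} _ = sym (+-identityʳ _)
downward-scale g {suc (suc (suc (suc h)))} (s≤s (s≤s (s≤s (s≤s ()))))

upward-high : ∀ g {h} → 4 ≤ h → upward g h ≡ 0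
upward-high g (s≤s (s≤s (s≤s (s≤s _)))) = refl

peak : ∀ {m} → ℤ → Vec Bool m → ℤ
peak h w = Vec.foldr₁ ℤ._⊔_ (heightsFrom h w)

visits : ∀ {m} → ℤ → Vec Bool m → ℕ
visits h w = Vec.count (ℤ._≟ + 2) (heightsFrom h w)

peak-∷ : ∀ {m} h b (w : Vec Bool m) → peak h (b ∷ w) ≡ h ℤ.⊔ peak (step b h) w
peak-∷ h b []      = refl
peak-∷ h b (_ ∷ _) = refl

height≤peak : ∀ {m} h (w : Vec Bool m) → h ℤ.≤ peak h w
height≤peak h []      = ℤ.≤-refl
height≤peak h (b ∷ w) = subst (h ℤ.≤_) (sym (peak-∷ h b w)) (ℤ.i≤i⊔j h _)

peak-tail : ∀ {m} h b (w : Vec Bool m) → peak h (b ∷ w) ℤ.< + 5 → peak (step b h) w ℤ.< + 5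
peak-tail h b w p = ℤ.≤-<-trans (ℤ.i≤j⊔i h _) (subst (ℤ._< + 5) (peak-∷ h b w) p)

peak-tail⁻ : ∀ {m} h b (w : Vec Bool m) → h ℤ.< + 5 → peak (step b h) w ℤ.< + 5 → peak h (b ∷ w) ℤ.< + 5
peak-tail⁻ h b w h<5 p with ℤ.⊔-sel h (peak (step b h) w)
... | inj₁ e = subst (ℤ._< + 5) (sym (trans (peak-∷ h b w) e)) h<5
... | inj₂ e = subst (ℤ._< + 5) (sym (trans (peak-∷ h b w) e)) p

visits-∷ : ∀ {m} h b (w : Vec Bool m) → 2 ^ visits (+ h) (b ∷ w) ≡ scale h * 2 ^ visits (step b (+ h)) w
visits-∷ 0 b w = sym (+-identityʳ _)
visits-∷ 1 b w = sym (+-identityʳ _)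
visits-∷ 2 b w = refl
visits-∷ (suc (suc (suc h))) b w = sym (+-identityʳ _)

step-up : ∀ h → step true (+ h) ≡ + suc h
step-up h = cong +_ (+-comm h 1)

head-height : ∀ {m} h (w : Vec Bool m) → lookup (heightsFrom h w) Fin.zero ≡ h
head-height h []      = refl
head-height h (b ∷ w) = refl

-- `visits` includes the current point of the path, whereas `completions` charges only for later
-- arrivals; the factor `scale h` makes up the difference.
completions-low : ∀ {m} (w : Vec Bool m) h →
  (∀ i → + 0 ℤ.≤ lookup (heightsFrom (+ h) w) i) → Vec.last (heightsFrom (+ h) w) ≡ + 0 →
  peak (+ h) w ℤ.< + 5 → scale h * completions (Vec.map forced w) h ≡ 2 ^ visits (+ h) w
completions-low [] zero nonneg last≡0 low = refl
completions-low [] (suc h) nonneg () low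
completions-low (true ∷ w) h nonneg last≡0 low = begin
  scale h * (upward g h + 0)              ≡⟨ cong (scale h *_) (trans (+-identityʳ _) (upward-scale g (≤-pred h+1<5))) ⟩
  scale h * (scale (suc h) * g (suc h))   ≡⟨ cong (scale h *_) rec ⟩
  scale h * 2 ^ visits (+ suc h) w        ≡⟨ cong (λ k → scale h * 2 ^ visits k w) (step-up h) ⟨
  scale h * 2 ^ visits (step true (+ h)) w ≡⟨ visits-∷ h true w ⟨
  2 ^ visits (+ h) (true ∷ w)             ∎
  where
  open ≡-Reasoning
  g = completions (Vec.map forced w)
  low′ : peak (+ suc h) w ℤ.< + 5
  low′ = subst (λ k → peak k w ℤ.< + 5) (step-up h) (peak-tail (+ h) true w low)
  h+1<5 : suc h < 5
  h+1<5 = ℤ.drop‿+<+ (ℤ.≤-<-trans (height≤peak (+ suc h) w) low′)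
  rec = completions-low w (suc h)
    (subst (λ k → ∀ i → + 0 ℤ.≤ lookup (heightsFrom k w) i) (step-up h) (nonneg ∘ Fin.suc))
    (subst (λ k → Vec.last (heightsFrom k w) ≡ + 0) (step-up h) last≡0) low′
completions-low (false ∷ w) zero nonneg last≡0 low
  with subst (+ 0 ℤ.≤_) (head-height -[1+ 0 ] w) (nonneg (Fin.suc Fin.zero))
... | ()
completions-low (false ∷ w) (suc h) nonneg last≡0 low = begin
  scale (suc h) * downward g (suc h)     ≡⟨ cong (scale (suc h) *_) (downward-scale g (≤-pred h+1<5)) ⟩
  scale (suc h) * (scale h * g h)        ≡⟨ cong (scale (suc h) *_) (completions-low w h (nonneg ∘ Fin.suc) last≡0 (peak-tail (+ suc h) false w low)) ⟩
  scale (suc h) * 2 ^ visits (+ h) w     ≡⟨ visits-∷ (suc h) false w ⟨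
  2 ^ visits (+ suc h) (false ∷ w)       ∎
  where
  open ≡-Reasoning
  g = completions (Vec.map forced w)
  h+1<5 : suc h < 5
  h+1<5 = ℤ.drop‿+<+ (ℤ.≤-<-trans (height≤peak (+ suc h) (false ∷ w)) low)

-- To exceed height 4 the path has to step up from it, and there `upward` vanishes; should it first
-- step down from height 0, `downward` vanishes instead.
completions-high : ∀ {m} (w : Vec Bool m) h → h < 5 → ¬ peak (+ h) w ℤ.< + 5 →
                   completions (Vec.map forced w) h ≡ 0
completions-high [] h h<5 high = ⊥-elim (high (ℤ.+<+ h<5))
completions-high (true ∷ w) h h<5 high with h <? 4
... | no h≮4 = trans (+-identityʳ _) (upward-high _ (≮⇒≥ h≮4))
... | yes h<4 = trans (+-identityʳ _) (trans (upward-scale _ h<4)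
  (trans (cong (scale (suc h) *_) rec) (*-zeroʳ (scale (suc h)))))
  where
  rec = completions-high w (suc h) (s≤s h<4)
    (λ p → high (peak-tail⁻ (+ h) true w (ℤ.+<+ h<5) (subst (λ k → peak k w ℤ.< + 5) (sym (step-up h)) p)))
completions-high (false ∷ w) zero h<5 high = refl
completions-high (false ∷ w) (suc h) h<5 high = trans (downward-scale _ (≤-pred h<5))
  (trans (cong (scale h *_) rec) (*-zeroʳ (scale h)))
  where
  rec = completions-high w h (<-trans (n<1+n h) h<5)
    (high ∘ peak-tail⁻ (+ suc h) false w (ℤ.+<+ h<5))

-- All matchings: the transfer matrix of two slots on the heights 0, 2, 4

matchings-at : ℕ → ℕ → ℕ
matchings-at n = completions (replicate (2 * n) unfixed)

matchings-at-suc : ∀ n h → matchings-at (suc n) h ≡ completions (replicate (suc (suc (2 * n))) unfixed) h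
matchings-at-suc n h = cong (λ m → completions (replicate m unfixed) h) (*-suc 2 n)

matchings-0 : ∀ n → matchings-at (suc n) 0 ≡ matchings-at n 0 + 2 * matchings-at n 2
matchings-0 n = trans (matchings-at-suc n 0) (solution (matchings-at n 0) (matchings-at n 2))
  where
  solution : ∀ x y → (2 * y + x) + 0 ≡ x + 2 * y
  solution = solve-∀

matchings-2 : ∀ n → matchings-at (suc n) 2 ≡ matchings-at n 0 + 4 * matchings-at n 2 + matchings-at n 4
matchings-2 n = trans (matchings-at-suc n 2) (solution (matchings-at n 0) (matchings-at n 2) (matchings-at n 4))
  where
  solution : ∀ x y z → (z + 2 * y) + (2 * y + x) ≡ x + 4 * y + z
  solution = solve-∀

matchings-4 : ∀ n → matchings-at (suc n) 4 ≡ 2 * matchings-at n 2 + matchings-at n 4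
matchings-4 n = trans (matchings-at-suc n 4) (+-comm (matchings-at n 4) _)

-- The transfer matrix with rows (1, 2, 0), (1, 4, 1), (0, 2, 1) has the eigenvalues 0, 1 and 5. The
-- part belonging to 0 dies after one step, so the closed forms hold from one pair on. At height 4
-- the value is (5^n - 1)/2, stated without subtraction.
matchings-closed : ∀ n → matchings-at (suc n) 0 * 2 ≡ 5 ^ n + 1 × matchings-at (suc n) 2 ≡ 5 ^ n
                       × matchings-at (suc n) 4 * 2 + 1 ≡ 5 ^ n
matchings-closed zero = refl , refl , refl
matchings-closed (suc n) with matchings-closed n
... | e0 , e2 , e4 =
  trans (cong (_* 2) (matchings-0 (suc n))) (trans (at-0 x y) (trans (cong₂ _+_ (cong (4 *_) e2) e0) (five-+ (5 ^ n)))) ,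
  -- Doubling and adding 1 brings the terms for heights 0 and 4 into the form of the induction
  -- hypotheses; both are cancelled afterwards.
  trans (matchings-2 (suc n)) (*-cancelʳ-≡ _ _ 2 (suc-injective
    (trans (at-2 x y z) (trans (cong₂ _+_ (cong₂ _+_ e0 (cong (8 *_) e2)) e4) (five-* (5 ^ n)))))) ,
  trans (cong (λ k → k * 2 + 1) (matchings-4 (suc n)))
    (trans (at-4 y z) (trans (cong₂ _+_ (cong (4 *_) e2) e4) (five (5 ^ n))))
  where
  x = matchings-at (suc n) 0
  y = matchings-at (suc n) 2
  z = matchings-at (suc n) 4
  at-0 : ∀ x y → (x + 2 * y) * 2 ≡ 4 * y + x * 2
  at-0 = solve-∀
  at-2 : ∀ x y z → suc ((x + 4 * y + z) * 2) ≡ x * 2 + 8 * y + (z * 2 + 1)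
  at-2 = solve-∀
  at-4 : ∀ y z → (2 * y + z) * 2 + 1 ≡ 4 * y + (z * 2 + 1)
  at-4 = solve-∀
  five-+ : ∀ p → 4 * p + (p + 1) ≡ 5 * p + 1
  five-+ = solve-∀
  five-* : ∀ p → (p + 1) + 8 * p + p ≡ suc (5 * p * 2)
  five-* = solve-∀
  five : ∀ p → 4 * p + p ≡ 5 * p
  five = solve-∀

-- The roots of λ² - 6λ + 5 are 1 and 5. Because of the eigenvalue 0 the recurrence begins at index
-- 1, not 0.
matchings-recurrence : ∀ k → matchings-at (3 + k) 0 + 5 * matchings-at (1 + k) 0 ≡ 6 * matchings-at (2 + k) 0
matchings-recurrence k = *-cancelʳ-≡ _ _ 2 (begin
  (x₂ + 5 * x₀) * 2                        ≡⟨ distribute x₂ x₀ ⟩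
  x₂ * 2 + 5 * (x₀ * 2)                    ≡⟨ cong₂ (λ p q → p + 5 * q) (closed (2 + k)) (closed k) ⟩
  (5 * (5 * 5 ^ k) + 1) + 5 * (5 ^ k + 1)  ≡⟨ powers (5 ^ k) ⟩
  6 * (5 * 5 ^ k + 1)                      ≡⟨ cong (6 *_) (closed (1 + k)) ⟨
  6 * (x₁ * 2)                             ≡⟨ *-assoc 6 x₁ 2 ⟨
  6 * x₁ * 2                               ∎)
  where
  open ≡-Reasoning
  closed : ∀ n → matchings-at (suc n) 0 * 2 ≡ 5 ^ n + 1
  closed = proj₁ ∘ matchings-closed
  x₀ = matchings-at (1 + k) 0
  x₁ = matchings-at (2 + k) 0
  x₂ = matchings-at (3 + k) 0
  distribute : ∀ x y → (x + 5 * y) * 2 ≡ x * 2 + 5 * (y * 2)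
  distribute = solve-∀
  powers : ∀ p → (5 * (5 * p) + 1) + 5 * (p + 1) ≡ 6 * (5 * p + 1)
  powers = solve-∀


-- All partitions: the transfer matrix of one vertex

partitions-at : ℕ → ℕ → ℕ
partitions-at k = completions (alternating k)

-- The equations say that the vector x k evolves by the transfer matrix of one vertex.
module Transfer (x : ℕ → ℕ → ℕ)
  (x-0 : ∀ k → x (suc k) 0 ≡ x k 0 + x k 1)
  (x-1 : ∀ k → x (suc k) 1 ≡ x k 0 + 2 * x k 1 + 2 * x k 2)
  (x-2 : ∀ k → x (suc k) 2 ≡ x k 1 + 3 * x k 2 + x k 3)
  (x-3 : ∀ k → x (suc k) 3 ≡ 2 * x k 2 + 3 * x k 3 + x k 4)
  (x-4 : ∀ k → x (suc k) 4 ≡ x k 3 + 2 * x k 4)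
  where

  linear : (c₀ c₁ c₂ c₃ c₄ k : ℕ) → ℕ
  linear c₀ c₁ c₂ c₃ c₄ k = c₀ * x k 0 + c₁ * x k 1 + c₂ * x k 2 + c₃ * x k 3 + c₄ * x k 4

  -- The coefficients form a row vector, which one step multiplies by the transfer matrix; the rows
  -- in `linear-1` to `linear-5` are therefore the top rows of its powers. Their first entries 1, 2,
  -- 5, 15, 52 are Bell numbers, since a forbidden pattern needs six vertices.
  linear-suc : ∀ c₀ c₁ c₂ c₃ c₄ k → linear c₀ c₁ c₂ c₃ c₄ (suc k) ≡
    linear (c₀ + c₁) (c₀ + 2 * c₁ + c₂) (2 * c₁ + 3 * c₂ + 2 * c₃) (c₂ + 3 * c₃ + c₄) (c₃ + 2 * c₄) k
  linear-suc c₀ c₁ c₂ c₃ c₄ k = trans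
    (cong₂ _+_ (cong₂ _+_ (cong₂ _+_ (cong₂ _+_ (cong (c₀ *_) (x-0 k)) (cong (c₁ *_) (x-1 k)))
                                     (cong (c₂ *_) (x-2 k)))
                          (cong (c₃ *_) (x-3 k)))
               (cong (c₄ *_) (x-4 k)))
    (solution c₀ c₁ c₂ c₃ c₄ (x k 0) (x k 1) (x k 2) (x k 3) (x k 4))
    where
    solution : ∀ c₀ c₁ c₂ c₃ c₄ x₀ x₁ x₂ x₃ x₄ →
      c₀ * (x₀ + x₁) + c₁ * (x₀ + 2 * x₁ + 2 * x₂) + c₂ * (x₁ + 3 * x₂ + x₃)
      + c₃ * (2 * x₂ + 3 * x₃ + x₄) + c₄ * (x₃ + 2 * x₄)
      ≡ (c₀ + c₁) * x₀ + (c₀ + 2 * c₁ + c₂) * x₁ + (2 * c₁ + 3 * c₂ + 2 * c₃) * x₂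
        + (c₂ + 3 * c₃ + c₄) * x₃ + (c₃ + 2 * c₄) * x₄
    solution = solve-∀

  linear-0 : ∀ k → x k 0 ≡ linear 1 0 0 0 0 k
  linear-0 k = solution (x k 0)
    where
    solution : ∀ x → x ≡ 1 * x + 0 + 0 + 0 + 0
    solution = solve-∀

  linear-1 : ∀ k → x (1 + k) 0 ≡ linear 1 1 0 0 0 k
  linear-1 k = trans (linear-0 (suc k)) (linear-suc 1 0 0 0 0 k)

  linear-2 : ∀ k → x (2 + k) 0 ≡ linear 2 3 2 0 0 k
  linear-2 k = trans (linear-1 (suc k)) (linear-suc 1 1 0 0 0 k)

  linear-3 : ∀ k → x (3 + k) 0 ≡ linear 5 10 12 2 0 k
  linear-3 k = trans (linear-2 (suc k)) (linear-suc 2 3 2 0 0 k)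

  linear-4 : ∀ k → x (4 + k) 0 ≡ linear 15 37 60 18 2 k
  linear-4 k = trans (linear-3 (suc k)) (linear-suc 5 10 12 2 0 k)

  linear-5 : ∀ k → x (5 + k) 0 ≡ linear 52 149 290 116 22 k
  linear-5 k = trans (linear-4 (suc k)) (linear-suc 15 37 60 18 2 k)

  -- Cayley-Hamilton for the transfer matrix, whose characteristic polynomial is λ⁵ - 11λ⁴ + 41λ³ -
  -- 61λ² + 31λ - 1; the negative terms are moved to the other side.
  recurrence : ∀ k →
    x (5 + k) 0 + 41 * x (3 + k) 0 + 31 * x (1 + k) 0 ≡ 11 * x (4 + k) 0 + 61 * x (2 + k) 0 + x k 0
  recurrence k = begin
    x (5 + k) 0 + 41 * x (3 + k) 0 + 31 * x (1 + k) 0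
      ≡⟨ cong₂ _+_ (cong₂ (λ p q → p + 41 * q) (linear-5 k) (linear-3 k)) (cong (31 *_) (linear-1 k)) ⟩
    linear 52 149 290 116 22 k + 41 * linear 5 10 12 2 0 k + 31 * linear 1 1 0 0 0 k
      ≡⟨ solution (x k 0) (x k 1) (x k 2) (x k 3) (x k 4) ⟩
    11 * linear 15 37 60 18 2 k + 61 * linear 2 3 2 0 0 k + x k 0
      ≡⟨ cong₂ (λ p q → 11 * p + 61 * q + x k 0) (linear-4 k) (linear-2 k) ⟨
    11 * x (4 + k) 0 + 61 * x (2 + k) 0 + x k 0 ∎
    where
    open ≡-Reasoning
    solution : ∀ x₀ x₁ x₂ x₃ x₄ →
      (52 * x₀ + 149 * x₁ + 290 * x₂ + 116 * x₃ + 22 * x₄)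
      + 41 * (5 * x₀ + 10 * x₁ + 12 * x₂ + 2 * x₃ + 0 * x₄)
      + 31 * (1 * x₀ + 1 * x₁ + 0 * x₂ + 0 * x₃ + 0 * x₄)
      ≡ 11 * (15 * x₀ + 37 * x₁ + 60 * x₂ + 18 * x₃ + 2 * x₄)
        + 61 * (2 * x₀ + 3 * x₁ + 2 * x₂ + 0 * x₃ + 0 * x₄) + x₀
    solution = solve-∀

partitions-recurrence : ∀ k →
  partitions-at (5 + k) 0 + 41 * partitions-at (3 + k) 0 + 31 * partitions-at (1 + k) 0
  ≡ 11 * partitions-at (4 + k) 0 + 61 * partitions-at (2 + k) 0 + partitions-at k 0
partitions-recurrence = Transfer.recurrence partitions-at
  (λ k → at-0 (p k 0) (p k 1))
  (λ k → at-1 (p k 0) (p k 1) (p k 2))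
  (λ k → at-2 (p k 1) (p k 2) (p k 3))
  (λ k → at-3 (p k 2) (p k 3) (p k 4))
  (λ k → at-4 (p k 3) (p k 4))
  where
  p = partitions-at
  at-0 : ∀ x₀ x₁ → x₀ + (x₁ + 0) + 0 ≡ x₀ + x₁
  at-0 = solve-∀
  at-1 : ∀ x₀ x₁ x₂ → x₁ + (2 * x₂ + 0) + (x₀ + (x₁ + 0)) ≡ x₀ + 2 * x₁ + 2 * x₂
  at-1 = solve-∀
  at-2 : ∀ x₁ x₂ x₃ → x₂ + (x₃ + 0) + (x₁ + (2 * x₂ + 0)) ≡ x₁ + 3 * x₂ + x₃
  at-2 = solve-∀
  at-3 : ∀ x₂ x₃ x₄ → x₃ + (x₄ + 0) + 2 * (x₂ + (x₃ + 0)) ≡ 2 * x₂ + 3 * x₃ + x₄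
  at-3 = solve-∀
  at-4 : ∀ x₃ x₄ → x₄ + 0 + (x₃ + (x₄ + 0)) ≡ x₃ + 2 * x₄
  at-4 = solve-∀

-- From recurrences to generating functions

sumUpTo-cong : ∀ n {f g : ℕ → ℤ} → (∀ k → f k ≡ g k) → sumUpTo n f ≡ sumUpTo n g
sumUpTo-cong zero    e = e 0
sumUpTo-cong (suc n) e = cong₂ ℤ._+_ (sumUpTo-cong n e) (e (suc n))

⊛-ogf-cong : ∀ f {a b : ℕ → ℕ} → (∀ n → a n ≡ b n) → ∀ k → (f ⊛ ogf a) k ≡ (f ⊛ ogf b) k
⊛-ogf-cong f e k = sumUpTo-cong k (λ j → cong (λ m → f j ℤ.* + m) (e (k ∸ j)))

sumUpTo-truncate : ∀ d k (f : ℕ → ℤ) → (∀ j → f (suc (d + j)) ≡ + 0) → sumUpTo (d + k) f ≡ sumUpTo d f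
sumUpTo-truncate d zero    f z rewrite +-identityʳ d = refl
sumUpTo-truncate d (suc k) f z rewrite +-suc d k | z k = trans (ℤ.+-identityʳ _) (sumUpTo-truncate d k f z)

-- A polynomial factor of degree at most `d` cuts the convolution down to `d + 1` terms at every
-- index from `d` on.
⊛-truncate : ∀ d k (f g : Series) → (∀ j → f (suc (d + j)) ≡ + 0) →
             (f ⊛ g) (d + k) ≡ sumUpTo d (λ j → f j ℤ.* g (d + k ∸ j))
⊛-truncate d k f g z = sumUpTo-truncate d k _ (λ j → trans (cong (ℤ._* _) (z j)) (ℤ.*-zeroˡ (g (d + k ∸ suc (d + j)))))

matchings-denominator partitions-denominator : Series
matchings-denominator  = poly (+ 1 ∷ - (+ 6) ∷ + 5 ∷ [])
partitions-denominator =
  poly (+ 1 ∷ - (+ 1) ∷ []) ⊛ poly (+ 1 ∷ - (+ 10) ∷ + 31 ∷ - (+ 30) ∷ + 1 ∷ [])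

-- The numerator has degree 2, so from index 3 on the coefficients must vanish; this is the
-- recurrence with its signs restored in ℤ.
matchings-series : ∀ (a : ℕ → ℕ) → (∀ k → a (3 + k) + 5 * a (1 + k) ≡ 6 * a (2 + k)) →
                   ∀ k → (matchings-denominator ⊛ ogf a) (3 + k) ≡ + 0
matchings-series a recurrence k = begin
  (matchings-denominator ⊛ ogf a) (2 + suc k)
    ≡⟨ ⊛-truncate 2 (suc k) matchings-denominator (ogf a) (λ _ → refl) ⟩
  + 1 ℤ.* + x₂ ℤ.+ - (+ 6) ℤ.* + x₁ ℤ.+ + 5 ℤ.* + x₀
    ≡⟨ rearrange (+ x₂) (+ x₁) (+ x₀) ⟩
  (+ x₂ ℤ.+ + 5 ℤ.* + x₀) ℤ.- + 6 ℤ.* + x₁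
    ≡⟨ cong₂ (λ p q → (+ x₂ ℤ.+ p) ℤ.- q) (ℤ.pos-* 5 x₀) (ℤ.pos-* 6 x₁) ⟨
  + (x₂ + 5 * x₀) ℤ.- + (6 * x₁)
    ≡⟨ ℤ.i≡j⇒i-j≡0 (cong +_ (recurrence k)) ⟩
  + 0 ∎
  where
  open ≡-Reasoning
  x₀ = a (1 + k)
  x₁ = a (2 + k)
  x₂ = a (3 + k)
  rearrange : ∀ x y z → + 1 ℤ.* x ℤ.+ - (+ 6) ℤ.* y ℤ.+ + 5 ℤ.* z ≡ (x ℤ.+ + 5 ℤ.* z) ℤ.- + 6 ℤ.* y
  rearrange = ℤ-Solver.solve-∀

partitions-series : ∀ (a : ℕ → ℕ) →
  (∀ k → a (5 + k) + 41 * a (3 + k) + 31 * a (1 + k) ≡ 11 * a (4 + k) + 61 * a (2 + k) + a k) →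
  ∀ k → (partitions-denominator ⊛ ogf a) (5 + k) ≡ + 0
partitions-series a recurrence k = begin
  (partitions-denominator ⊛ ogf a) (5 + k)
    ≡⟨ ⊛-truncate 5 k partitions-denominator (ogf a) vanishes ⟩
  + 1 ℤ.* + x₅ ℤ.+ - (+ 11) ℤ.* + x₄ ℤ.+ + 41 ℤ.* + x₃ ℤ.+ - (+ 61) ℤ.* + x₂ ℤ.+ + 31 ℤ.* + x₁
    ℤ.+ - (+ 1) ℤ.* + x₀
    ≡⟨ rearrange (+ x₅) (+ x₄) (+ x₃) (+ x₂) (+ x₁) (+ x₀) ⟩
  (+ x₅ ℤ.+ + 41 ℤ.* + x₃ ℤ.+ + 31 ℤ.* + x₁) ℤ.- (+ 11 ℤ.* + x₄ ℤ.+ + 61 ℤ.* + x₂ ℤ.+ + x₀)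
    ≡⟨ cong₂ ℤ._-_ (cong₂ (λ p q → + x₅ ℤ.+ p ℤ.+ q) (ℤ.pos-* 41 x₃) (ℤ.pos-* 31 x₁))
                   (cong₂ (λ p q → p ℤ.+ q ℤ.+ + x₀) (ℤ.pos-* 11 x₄) (ℤ.pos-* 61 x₂)) ⟨
  + (x₅ + 41 * x₃ + 31 * x₁) ℤ.- + (11 * x₄ + 61 * x₂ + x₀)
    ≡⟨ ℤ.i≡j⇒i-j≡0 (cong +_ (recurrence k)) ⟩
  + 0 ∎
  where
  open ≡-Reasoning
  x₀ = a k
  x₁ = a (1 + k)
  x₂ = a (2 + k)
  x₃ = a (3 + k)
  x₄ = a (4 + k)
  x₅ = a (5 + k)
  vanishes : ∀ j → partitions-denominator (6 + j) ≡ + 0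
  -- One factor is linear, so two terms remain, and both use coefficients of the other factor beyond
  -- its degree 4.
  vanishes j = ⊛-truncate 1 (5 + j) (poly (+ 1 ∷ - (+ 1) ∷ []))
                 (poly (+ 1 ∷ - (+ 10) ∷ + 31 ∷ - (+ 30) ∷ + 1 ∷ [])) (λ _ → refl)
  rearrange : ∀ x₅ x₄ x₃ x₂ x₁ x₀ →
    + 1 ℤ.* x₅ ℤ.+ - (+ 11) ℤ.* x₄ ℤ.+ + 41 ℤ.* x₃ ℤ.+ - (+ 61) ℤ.* x₂ ℤ.+ + 31 ℤ.* x₁ ℤ.+ - (+ 1) ℤ.* x₀
    ≡ (x₅ ℤ.+ + 41 ℤ.* x₃ ℤ.+ + 31 ℤ.* x₁) ℤ.- (+ 11 ℤ.* x₄ ℤ.+ + 61 ℤ.* x₂ ℤ.+ x₀)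
  rearrange = ℤ-Solver.solve-∀

matchings-ogf : ∀ k → (matchings-denominator ⊛ ogf (λ n → matchings-at n 0)) k
                    ≡ poly (+ 1 ∷ - (+ 5) ∷ + 2 ∷ []) k
matchings-ogf 0 = refl
matchings-ogf 1 = refl
matchings-ogf 2 = refl
matchings-ogf (suc (suc (suc k))) = matchings-series (λ n → matchings-at n 0) matchings-recurrence k

partitions-ogf : ∀ k → (partitions-denominator ⊛ ogf (λ n → partitions-at n 0)) k
                     ≡ poly (+ 1 ∷ - (+ 10) ∷ + 32 ∷ - (+ 37) ∷ + 12 ∷ []) k
partitions-ogf 0 = refl
partitions-ogf 1 = refl
partitions-ogf 2 = refl
partitions-ogf 3 = refl
partitions-ogf 4 = refl
partitions-ogf (suc (suc (suc (suc (suc k))))) =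
  partitions-series (λ n → partitions-at n 0) partitions-recurrence k

theorem6p3 : (∀ (n : ℕ) (w : Vec Bool (2 * n)) → IsDyck w →
    (height w <ℤ + 5 → #MF n w p123 p321 ≡ 2 ^ η w) ×
    (¬ (height w <ℤ + 5) → #MF n w p123 p321 ≡ 0))
    × (∀ (k : ℕ) → (poly (+ 1 ∷ - (+ 6) ∷ + 5 ∷ []) ⊛ ogf (λ n → #Mn n p123 p321)) k
    ≡ poly (+ 1 ∷ - (+ 5) ∷ + 2 ∷ []) k)
    × (∀ (n : ℕ) → 1 ≤ n → #Mn n p123 p321 ≡ (5 ^ (n ∸ 1) + 1) / 2)
    × (∀ (k : ℕ) → ((poly (+ 1 ∷ - (+ 1) ∷ []) ⊛ poly (+ 1 ∷ - (+ 10) ∷ + 31 ∷ - (+ 30) ∷ + 1 ∷ []))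
    ⊛ ogf (λ n → #Pn n p123 p321)) k
    ≡ poly (+ 1 ∷ - (+ 10) ∷ + 32 ∷ - (+ 37) ∷ + 12 ∷ []) k)
theorem6p3 =
  (λ n w (nonneg , last≡0) →
    (λ low → trans (#MF-completions n w)
               -- This inserts `scale 0`, which is 1: the starting point of the path brings no
               -- factor.
               (trans (sym (+-identityʳ _)) (completions-low w 0 nonneg last≡0 low))) ,
    (λ high → trans (#MF-completions n w) (completions-high w 0 z<s high))) ,
  (λ k → trans (⊛-ogf-cong matchings-denominator #Mn-completions k) (matchings-ogf k)) ,
  -- The closed form gives twice the number of matchings, so the division by 2 is exact.
  (λ { (suc n) _ → trans (#Mn-completions (suc n))
         (trans (sym (m*n/n≡m (matchings-at (suc n) 0) 2)) (cong (_/ 2) (proj₁ (matchings-closed n)))) }) ,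
  (λ k → trans (⊛-ogf-cong partitions-denominator #Pn-completions k) (partitions-ogf k))
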